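{- Let $\Theta_1,\dots,\Theta_n$ be hyperplanes in $\mathbb R^d$ with $\bigcap_i\Theta_i=\{0\}$, $\Theta_e=\ker\ell_e$ for linear forms $\ell_e$, and let $\mathcal A=\{H_1,\dots,H_n\}$ be the corresponding complexified arrangement in $\mathbb C^d$. Then $\mathcal L=\{\alpha_{\vec z}:\vec z\in\mathbb C^d\}$ is an oriented interval greedoid over $(E_{\mathcal A},\mathcal F_{\mathcal A})$, i.e. $(E_{\mathcal A},\mathcal F_{\mathcal A},\mathcal L)$ is an oriented interval greedoid.
   Context: Extend each $\ell_e$ $\mathbb C$-linearly to $\mathbb C^d$; $H_e=\{\vec z:\ell_e(\vec z)=0\}$ and $H_e^{\Re}=\{\vec z:\mathrm{Im}(\ell_e(\vec z))=0\}$. Let $E_{\mathcal A}=\{H_1,\dots,H_n,H_1^\Re,\dots,H_n^\Re\}$ and $\mathcal L_{\mathcal A}$ the lattice of all intersections of subspaces from $E_{\mathcal A}$ ordered by inclusion; $\mathcal F_{\mathcal A}=\{\{h_1,\dots,h_k\}\subseteq E_{\mathcal A}:\mathbb C^d\gtrdot h_1\gtrdot h_1\cap h_2\gtrdot\cdots\gtrdot h_1\cap\cdots\cap h_k\}$ (covers in $\mathcal L_{\mathcal A}$); $(E_{\mathcal A},\mathcal F_{\mathcal A})$ is an interval greedoid. For $z=x+iy\in\mathbb C$: $\sigma_\Re(z)=1$ if $y\neq0$, $+$ if $y=0,x>0$, $-$ if $y=0,x<0$, $0$ if $z=0$; $\sigma_\Im(z)=+,-,0$ according as $y>0,y<0,y=0$.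 For $\vec z\in\mathbb C^d$, $\alpha_{\vec z}(H_i^\Re)=\sigma_\Im(\ell_i(\vec z))$ and $\alpha_{\vec z}(H_i)=\sigma_\Re(\ell_i(\vec z))$. Interval greedoid: finite $E$, nonempty family $\mathcal F$ with (IG1) each nonempty $X\in\mathcal F$ has $x$ with $X\setminus\{x\}\in\mathcal F$; (IG2) if $|X|>|Y|$ there is $x\in X\setminus Y$ with $Y\cup\{x\}\in\mathcal F$; (IG3) if $X\subseteq Y\subseteq Z$ in $\mathcal F$, $e\notin Z$, $X\cup\{e\},Z\cup\{e\}\in\mathcal F$, then $Y\cup\{e\}\in\mathcal F$. $\Gamma(X)=\{x\in E\setminus X:X\cup\{x\}\in\mathcal F\}$; $X\sim Y$ iff $\Gamma(X)=\Gamma(Y)$; classes $[X]$ are flats; $\Phi$ the set of flats ordered by $[X]\le[Y]$ iff there is $Z\subseteq E\setminus Y$ with $Y\cup Z\in\mathcal F$ and $Y\cup Z\sim X$ (a lattice). For a flat $A=[X]$: $\Gamma(A)=\Gamma(X)$, $\xi(A)=\bigcup_{X'\sim X}X'$; $\mu(S)=[X]$ for $X$ inclusion-maximal feasible in $S$; join $A\vee B=\mu(\xi(A)\cap\xi(B))$. A covector is $\alpha:E\to\{0,+,-,1\}$ such that for some flat $A=\mathrm{supp}(\alpha)$, $\alpha\in\{+,-\}$ on $\Gamma(A)$, $0$ on $\xi(A)$, $1$ elsewhere. Symbols ordered $0<+<1$, $0<-<1$. Product: with $C=\mathrm{supp}\,\alpha\vee\mathrm{supp}\,\beta$, $(\alpha\circ\beta)(e)=\beta(e)$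 if $e\in\Gamma(C)\cup\xi(C)$ and $\beta(e)>\alpha(e)$; $\alpha(e)$ if $e\in\Gamma(C)\cup\xi(C)$ otherwise; $1$ otherwise. $-\alpha$ swaps $+,-$; $S(\alpha,\beta)=\{e:\alpha(e)=-\beta(e)\in\{+,-\}\}$. Oriented interval greedoid: $(E,\mathcal F,\mathcal L)$, $\mathcal L$ a set of covectors with (OG1) $\mathrm{supp}:\mathcal L\to\Phi$ surjective; (OG2) $-\mathcal L=\mathcal L$; (OG3) closed under $\circ$; (OG4) if $\alpha,\beta\in\mathcal L$, $x\in S(\alpha,\beta)$, $(\alpha\circ\beta)(x)\ne1$, some $\gamma\in\mathcal L$ has $\gamma(x)=0$ and $\gamma(y)=(\alpha\circ\beta)(y)=(\beta\circ\alpha)(y)$ for all $y\notin S(\alpha,\beta)$ with $(\alpha\circ\beta)(y)\neq1$. -}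

module Defs where

open import Level using (0ℓ)
open import Data.Nat using (ℕ; zero; suc) renaming (_+_ to _+ℕ_; _<_ to _<ℕ_)
open import Data.Fin using (Fin; splitAt) renaming (zero to fzero; suc to fsuc)
open import Data.Fin.Subset using (Subset; ⊥; ⁅_⁆; _∪_; _-_; _∈_; _∉_; _⊆_; ∣_∣; Nonempty)
open import Data.Product using (Σ; ∃; ∃-syntax; _×_; _,_)
open import Data.Sum using (_⊎_; inj₁; inj₂)
open import Data.Bool using (Bool; true; false; if_then_else_)
open import Data.Unit using (⊤)
open import Data.List using (List; []; _∷_)
open import Relation.Nullary using (¬_)
open import Relation.Binary.PropositionalEquality using (_≡_)
open import Relation.Binary.Structures using (IsStrictTotalOrder)
open import Relation.Binary.Definitions using (Tri; tri<; tri≈; tri>)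
open import Algebra.Structures using (IsCommutativeRing)

-- The real numbers, axiomatised as a complete ordered field
-- (unique up to isomorphism, so quantifying over all such is faithful).

record RealField : Set₁ where
  infixl 6 _+_
  infixl 7 _*_
  infix 4 _<_ _≤_
  field
    ℝ : Set
    0r 1r : ℝ
    _+_ _*_ : ℝ → ℝ → ℝ
    -_ : ℝ → ℝ
    isCommutativeRing : IsCommutativeRing _≡_ _+_ _*_ -_ 0r 1r
    0≢1 : ¬ (0r ≡ 1r)
    inverse : ∀ x → ¬ (x ≡ 0r) → ∃[ y ] (x * y ≡ 1r)
    _<_ : ℝ → ℝ → Set
    isStrictTotalOrder : IsStrictTotalOrder _≡_ _<_
    +-mono-< : ∀ {x y} z → x < y → x + z < y + z
    *-pos : ∀ {x y} → 0r < x → 0r < y → 0r < x * y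
  _≤_ : ℝ → ℝ → Set
  x ≤ y = x < y ⊎ x ≡ y
  field
    complete : (P : ℝ → Set) → ∃[ x ] P x → ∃[ b ] (∀ x → P x → x ≤ b) →
               ∃[ s ] ((∀ x → P x → x ≤ s) × (∀ b → (∀ x → P x → x ≤ b) → s ≤ b))
  compare = IsStrictTotalOrder.compare isStrictTotalOrder

data Sym : Set where
  𝟘 ⊕ ⊖ 𝟙 : Sym

_>ˢ_ : Sym → Sym → Bool
⊕ >ˢ 𝟘 = true
⊖ >ˢ 𝟘 = true
𝟙 >ˢ 𝟘 = true
𝟙 >ˢ ⊕ = true
𝟙 >ˢ ⊖ = true
_ >ˢ _ = false

negˢ : Sym → Sym
negˢ ⊕ = ⊖
negˢ ⊖ = ⊕
negˢ s = s

module Greedoid {m : ℕ} (F : Subset m → Set) where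

  IsIntervalGreedoid : Set
  IsIntervalGreedoid =
    (∃[ X ] F X)
    × (∀ X → F X → Nonempty X → ∃[ x ] (x ∈ X × F (X - x)))
    × (∀ X Y → F X → F Y → ∣ Y ∣ <ℕ ∣ X ∣ → ∃[ x ] (x ∈ X × x ∉ Y × F (Y ∪ ⁅ x ⁆)))
    × (∀ X Y Z e → F X → F Y → F Z → X ⊆ Y → Y ⊆ Z → e ∉ Z →
         F (X ∪ ⁅ e ⁆) → F (Z ∪ ⁅ e ⁆) → F (Y ∪ ⁅ e ⁆))

  Γ : Subset m → Fin m → Set
  Γ X x = x ∉ X × F (X ∪ ⁅ x ⁆)

  _∼_ : Subset m → Subset m → Set
  X ∼ Y = ∀ x → (Γ X x → Γ Y x) × (Γ Y x → Γ X x)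

  ξ : Subset m → Fin m → Set
  ξ X e = ∃[ X' ] (F X' × X' ∼ X × e ∈ X')

  -- X is an inclusion-maximal feasible set contained in S  (so μ(S) = [X])
  MaxFeasibleIn : (Fin m → Set) → Subset m → Set
  MaxFeasibleIn S X =
    F X × (∀ e → e ∈ X → S e) ×
    (∀ Y → F Y → X ⊆ Y → (∀ e → e ∈ Y → S e) → Y ⊆ X)

  -- α is a covector whose support is the flat [X]
  CovectorAt : Subset m → (Fin m → Sym) → Set
  CovectorAt X α = F X × (∀ e →
      (Γ X e → α e ≡ ⊕ ⊎ α e ≡ ⊖)
    × (ξ X e → α e ≡ 𝟘)
    × (¬ Γ X e → ¬ ξ X e → α e ≡ 𝟙))

  Covector : (Fin m → Sym) → Set
  Covector α = ∃[ X ] CovectorAt X α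

  -- γ = α ∘ β   (C = supp α ∨ supp β = μ(ξ(supp α) ∩ ξ(supp β)), represented by XC)
  IsProduct : (Fin m → Sym) → (Fin m → Sym) → (Fin m → Sym) → Set
  IsProduct α β γ = ∃[ XA ] ∃[ XB ] ∃[ XC ]
    ( CovectorAt XA α × CovectorAt XB β
    × MaxFeasibleIn (λ e → ξ XA e × ξ XB e) XC
    × (∀ e → ((Γ XC e ⊎ ξ XC e) → γ e ≡ (if β e >ˢ α e then β e else α e))
           × (¬ (Γ XC e ⊎ ξ XC e) → γ e ≡ 𝟙)))

  Sep : (Fin m → Sym) → (Fin m → Sym) → Fin m → Set
  Sep α β e = (α e ≡ ⊕ × β e ≡ ⊖) ⊎ (α e ≡ ⊖ × β e ≡ ⊕)

  IsOrientedIntervalGreedoid : ((Fin m → Sym) → Set) → Set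
  IsOrientedIntervalGreedoid L =
    IsIntervalGreedoid
    × (∀ α → L α → Covector α)
    × (∀ X → F X → ∃[ α ] (L α × CovectorAt X α))
    × (∀ α → L α → L (λ e → negˢ (α e)))
    × (∀ α β γ → L α → L β → IsProduct α β γ → L γ)
    × (∀ α β αβ βα x → L α → L β → IsProduct α β αβ → IsProduct β α βα →
         Sep α β x → ¬ (αβ x ≡ 𝟙) →
         ∃[ γ ] (L γ × γ x ≡ 𝟘 ×
           (∀ y → ¬ Sep α β y → ¬ (αβ y ≡ 𝟙) → (γ y ≡ αβ y × γ y ≡ βα y))))

module Arrangement (R : RealField) where
  open RealField R

  sumF : ∀ {d} → (Fin d → ℝ) → ℝ
  sumF {zero} f = 0r
  sumF {suc d} f = f fzero + sumF (λ j → f (fsuc j))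

  lin : ∀ {d} → (Fin d → ℝ) → (Fin d → ℝ) → ℝ
  lin c x = sumF (λ j → c j * x j)

  ℂ^ : ℕ → Set
  ℂ^ d = (Fin d → ℝ) × (Fin d → ℝ)

  re im : ∀ {d} → ℂ^ d → Fin d → ℝ
  re (x , y) = x
  im (x , y) = y

  -- the complexification of ℓ_e: ℓ_e(x + i y) = ℓ_e(x) + i ℓ_e(y)
  reℓ imℓ : ∀ {d} → (Fin d → ℝ) → ℂ^ d → ℝ
  reℓ c z = lin c (re z)
  imℓ c z = lin c (im z)

  σIm : ℝ → Sym
  σIm y with compare 0r y
  ... | tri< _ _ _ = ⊕
  ... | tri≈ _ _ _ = 𝟘
  ... | tri> _ _ _ = ⊖

  σRe : ℝ → ℝ → Sym
  σRe x y with compare 0r y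
  ... | tri< _ _ _ = 𝟙
  ... | tri> _ _ _ = 𝟙
  ... | tri≈ _ _ _ = σIm x

  module _ {d n : ℕ} (ℓ : Fin n → Fin d → ℝ) where
    -- ground set E_𝒜 = {H_1..H_n, H_1^ℜ..H_n^ℜ} indexed by Fin (n + n):
    -- index i < n is H_i, index n + i is H_i^ℜ.
    InE : Fin (n +ℕ n) → ℂ^ d → Set
    InE k z with splitAt n k
    ... | inj₁ i = reℓ (ℓ i) z ≡ 0r × imℓ (ℓ i) z ≡ 0r
    ... | inj₂ i = imℓ (ℓ i) z ≡ 0r

    Cap : Subset (n +ℕ n) → ℂ^ d → Set
    Cap T z = ∀ k → k ∈ T → InE k z

    _⊑_ : (ℂ^ d → Set) → (ℂ^ d → Set) → Set
    U ⊑ V = ∀ z → U z → V z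

    _⊏_ : (ℂ^ d → Set) → (ℂ^ d → Set) → Set
    U ⊏ V = U ⊑ V × ¬ (V ⊑ U)

    Covers : (ℂ^ d → Set) → (ℂ^ d → Set) → Set
    Covers U V = V ⊏ U × ¬ (∃[ T ] (V ⊏ Cap T × Cap T ⊏ U))

    ChainFrom : Subset (n +ℕ n) → List (Fin (n +ℕ n)) → Set
    ChainFrom S [] = ⊤
    ChainFrom S (h ∷ hs) = Covers (Cap S) (Cap (S ∪ ⁅ h ⁆)) × ChainFrom (S ∪ ⁅ h ⁆) hs

    toSet : List (Fin (n +ℕ n)) → Subset (n +ℕ n)
    toSet [] = ⊥
    toSet (h ∷ hs) = ⁅ h ⁆ ∪ toSet hs

    FA : Subset (n +ℕ n) → Set
    FA X = ∃[ hs ] (ChainFrom ⊥ hs × X ≡ toSet hs)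

    alpha : ℂ^ d → Fin (n +ℕ n) → Sym
    alpha z k with splitAt n k
    ... | inj₁ i = σRe (reℓ (ℓ i) z) (imℓ (ℓ i) z)
    ... | inj₂ i = σIm (imℓ (ℓ i) z)

    LA : (Fin (n +ℕ n) → Sym) → Set
    LA α = ∃[ z ] (∀ k → α k ≡ alpha z k)

  Θ : ∀ {d} → (Fin d → ℝ) → (Fin d → ℝ) → Set
  Θ c x = lin c x ≡ 0r

{-# OPTIONS --safe #-}
module Submission where

open import Defs
open import Algebra.Bundles using (CommutativeRing)
import Algebra.Solver.Ring.NaturalCoefficients.Default as SemiringSolver
open import Data.Bool using (if_then_else_)
open import Data.Fin using (Fin; splitAt; _↑ˡ_; _↑ʳ_) renaming (zero to fzero; suc to fsuc)
open import Data.Fin.Properties using (any?; splitAt-↑ˡ; splitAt-↑ʳ; splitAt⁻¹-↑ˡ; splitAt⁻¹-↑ʳ)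
  renaming (_≟_ to _≟ᶠ_)
open import Data.Fin.Subset
  using (Subset; inside; outside; ⊥; ⁅_⁆; _∪_; _─_; _-_; _∈_; _∉_; _⊆_; ∣_∣; Nonempty)
open import Data.Fin.Subset.Properties
  using (_∈?_; ∉⊥; x∈⁅x⁆; x∈⁅y⁆⇒x≡y; p⊆p∪q; q⊆p∪q; x∈p∪q⁻; p─q⊆p; ∪-identityˡ; ∪-identityʳ; ∪-assoc;
         nonempty?; Empty-unique; ⊆-antisym; x∈p∧x∉q⇒x∈p─q; x∈p∧x≢y⇒x∈p-y;
         p⊆q⇒∣p∣≤∣q∣; p⊂q⇒∣p∣<∣q∣; x∈p⇒∣p-x∣<∣p∣)
open import Data.List using (List; []; _∷_; _∷ʳ_; allFin; filter)
open import Data.List.Membership.Propositional using () renaming (_∈_ to _∈ᴸ_)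
open import Data.List.Membership.Propositional.Properties using (∈-filter⁺; ∈-filter⁻; ∈-allFin)
open import Data.List.Relation.Unary.Any using () renaming (here to hereᴸ; there to thereᴸ)
open import Data.Nat using (ℕ; s≤s) renaming (_+_ to _+ℕ_; _≤_ to _≤ℕ_; _<_ to _<ℕ_)
import Data.Nat.Properties as ℕ
open import Data.Product using (∃-syntax; _×_; _,_; proj₁; proj₂; swap)
open import Data.Sum using (_⊎_; inj₁; inj₂; map₂; fromInj₂)
open import Data.Unit using (tt)
open import Data.Vec using ([]; _∷_; here; there)
open import Function using (_∘_; case_of_)
open import Level using (0ℓ)
open import Relation.Binary.Definitions using (tri<; tri≈; tri>)
open import Relation.Binary.PropositionalEquality
open import Relation.Binary.Structures using (IsStrictTotalOrder)
open import Relation.Nullary using (¬_; Dec; yes; no; contradiction; ¬?; _×-dec_; _⊎-dec_)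
open import Relation.Nullary.Decidable using (decidable-stable)

-- Write φ_e for the real linear form z = x + iy ↦ ℓ_i(x) if e = H_i, and z ↦ ℓ_i(y) if e = H_i^ℜ,
-- and put ρ(H_i) = ρ(H_i^ℜ) = H_i^ℜ, so that the subspace e is the common kernel of φ_e and φ_ρ(e).
-- In the linear matroid of the forms φ_e, a set X is feasible iff it is independent and cl(X)
-- contains ρ(X); then e ∈ Γ(X) iff e ∉ cl(X) and ρ(e) ∈ cl(X ∪ e), and ξ(X) = cl(X). Hence a flat
-- amounts to a ρ-stable closed set, the support of α_z is the set of e with φ_e(z) = φ_ρ(e)(z) = 0,
-- and generic points of kernels realise every flat. The product of α_v and α_w is α of v + εw for
-- small ε > 0, and elimination at x is solved by v + tw for the t > 0 with φ_x(v + tw) = 0.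

-- Finite subsets

-- The subspace H_i has real codimension two, yet it is recorded by the single form Re ℓ_i. This
-- suffices because a cover in the lattice drops only one real dimension: if the current
-- intersection does not lie in H_i^ℜ, cutting with H_i^ℜ gives a subspace strictly between it and
-- its intersection with H_i. So H_i can be adjoined only once Im ℓ_i already vanishes, and for
-- feasible X the common kernel of the chosen forms is the full intersection. Dimensions are never
-- computed; the exchange property replaces them. For products, a small ε creates no cancellation,
-- so the zeros of a form at v + εw come from common zeros at v and w. For elimination t is dictated
-- by x and may be large, but (OG4) restricts only those y where the product is not 𝟙 and the two
-- symbols are not opposite, and there cancellation is impossible for every t > 0. Arguments by
-- contradiction are constructive, since Gaussian elimination decides closure.

x∈p─q⇒x∉q : ∀ {n} (p q : Subset n) {x} → x ∈ p ─ q → x ∉ q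
x∈p─q⇒x∉q (_ ∷ _) (outside ∷ _) here ()
x∈p─q⇒x∉q (_ ∷ p) (inside ∷ q) (there x∈p─q) (there x∈q) = x∈p─q⇒x∉q p q x∈p─q x∈q
x∈p─q⇒x∉q (_ ∷ p) (outside ∷ q) (there x∈p─q) (there x∈q) = x∈p─q⇒x∉q p q x∈p─q x∈q

x∉p-x : ∀ {n} (p : Subset n) x → x ∉ p - x
x∉p-x p x x∈p-x = x∈p─q⇒x∉q p ⁅ x ⁆ x∈p-x (x∈⁅x⁆ x)

p-x⊆p : ∀ {n} (p : Subset n) x → p - x ⊆ p
p-x⊆p p x = p─q⊆p p ⁅ x ⁆

x∈p∪⁅x⁆ : ∀ {n} (p : Subset n) x → x ∈ p ∪ ⁅ x ⁆
x∈p∪⁅x⁆ p x = q⊆p∪q p ⁅ x ⁆ (x∈⁅x⁆ x)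

x∈p∪⁅y⁆⁻ : ∀ {n} (p : Subset n) {x y} → x ∈ p ∪ ⁅ y ⁆ → x ∈ p ⊎ x ≡ y
x∈p∪⁅y⁆⁻ p {x} {y} x∈ with x∈p∪q⁻ p ⁅ y ⁆ x∈
... | inj₁ x∈p = inj₁ x∈p
... | inj₂ x∈y = inj₂ (x∈⁅y⁆⇒x≡y y x∈y)

∪-all : ∀ {n} {P : Fin n → Set} {p : Subset n} {x} →
  (∀ y → y ∈ p → P y) → P x → ∀ y → y ∈ p ∪ ⁅ x ⁆ → P y
∪-all {p = p} p⊆P Px y y∈ with x∈p∪⁅y⁆⁻ p y∈
... | inj₁ y∈p = p⊆P y y∈p
... | inj₂ refl = Px

∣p∪⁅x⁆∣≤1+∣p∣ : ∀ {n} (p : Subset n) x → ∣ p ∪ ⁅ x ⁆ ∣ ≤ℕ ℕ.suc ∣ p ∣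
∣p∪⁅x⁆∣≤1+∣p∣ (outside ∷ p) fzero rewrite ∪-identityʳ p = ℕ.≤-refl
∣p∪⁅x⁆∣≤1+∣p∣ (inside ∷ p) fzero rewrite ∪-identityʳ p = ℕ.n≤1+n _
∣p∪⁅x⁆∣≤1+∣p∣ (outside ∷ p) (fsuc x) = ∣p∪⁅x⁆∣≤1+∣p∣ p x
∣p∪⁅x⁆∣≤1+∣p∣ (inside ∷ p) (fsuc x) = s≤s (∣p∪⁅x⁆∣≤1+∣p∣ p x)

p⊆[p-x]∪⁅x⁆ : ∀ {n} (p : Subset n) x → p ⊆ (p - x) ∪ ⁅ x ⁆
p⊆[p-x]∪⁅x⁆ p x {y} y∈p with y ≟ᶠ x
... | yes refl = x∈p∪⁅x⁆ (p - x) x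
... | no y≢x = p⊆p∪q ⁅ x ⁆ (x∈p∧x≢y⇒x∈p-y y∈p y≢x)

∣p∣≤1+∣p-x∣ : ∀ {n} (p : Subset n) x → ∣ p ∣ ≤ℕ ℕ.suc ∣ p - x ∣
∣p∣≤1+∣p-x∣ p x = ℕ.≤-trans (p⊆q⇒∣p∣≤∣q∣ (p⊆[p-x]∪⁅x⁆ p x)) (∣p∪⁅x⁆∣≤1+∣p∣ (p - x) x)

-- Signs and perturbations

infixr 7 _∘ˢ_

-- Unfolds to the conditional in `IsProduct`, so that `product-spec` can rewrite both arguments by
-- congruence.
_∘ˢ_ : Sym → Sym → Sym
s ∘ˢ t = if t >ˢ s then t else s

data Opposite : Sym → Sym → Set where
  ⊕⊖ : Opposite ⊕ ⊖
  ⊖⊕ : Opposite ⊖ ⊕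

opposite? : ∀ s t → Dec (Opposite s t)
opposite? 𝟘 _ = no λ ()
opposite? 𝟙 _ = no λ ()
opposite? ⊕ 𝟘 = no λ ()
opposite? ⊕ ⊕ = no λ ()
opposite? ⊕ ⊖ = yes ⊕⊖
opposite? ⊕ 𝟙 = no λ ()
opposite? ⊖ 𝟘 = no λ ()
opposite? ⊖ ⊕ = yes ⊖⊕
opposite? ⊖ ⊖ = no λ ()
opposite? ⊖ 𝟙 = no λ ()

opposite-sym : ∀ {s t} → Opposite s t → Opposite t s
opposite-sym ⊕⊖ = ⊖⊕
opposite-sym ⊖⊕ = ⊕⊖

opposite⇒± : ∀ {s t} → Opposite s t → (s ≡ ⊕ × t ≡ ⊖) ⊎ (s ≡ ⊖ × t ≡ ⊕)
opposite⇒± ⊕⊖ = inj₁ (refl , refl)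
opposite⇒± ⊖⊕ = inj₂ (refl , refl)

±⇒opposite : ∀ {s t} → (s ≡ ⊕ × t ≡ ⊖) ⊎ (s ≡ ⊖ × t ≡ ⊕) → Opposite s t
±⇒opposite (inj₁ (refl , refl)) = ⊕⊖
±⇒opposite (inj₂ (refl , refl)) = ⊖⊕

∘ˢ-opposite : ∀ {s t} → Opposite s t → s ∘ˢ t ≡ s
∘ˢ-opposite ⊕⊖ = refl
∘ˢ-opposite ⊖⊕ = refl

∘ˢ-𝟘 : ∀ s t → s ∘ˢ t ≡ 𝟘 → s ≡ 𝟘 × t ≡ 𝟘
∘ˢ-𝟘 𝟘 𝟘 _ = refl , refl
∘ˢ-𝟘 𝟘 ⊕ ()
∘ˢ-𝟘 𝟘 ⊖ ()
∘ˢ-𝟘 𝟘 𝟙 ()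
∘ˢ-𝟘 ⊕ 𝟘 ()
∘ˢ-𝟘 ⊕ ⊕ ()
∘ˢ-𝟘 ⊕ ⊖ ()
∘ˢ-𝟘 ⊕ 𝟙 ()
∘ˢ-𝟘 ⊖ 𝟘 ()
∘ˢ-𝟘 ⊖ ⊕ ()
∘ˢ-𝟘 ⊖ ⊖ ()
∘ˢ-𝟘 ⊖ 𝟙 ()
∘ˢ-𝟘 𝟙 𝟘 ()
∘ˢ-𝟘 𝟙 ⊕ ()
∘ˢ-𝟘 𝟙 ⊖ ()
∘ˢ-𝟘 𝟙 𝟙 ()

module Signs (R : RealField) where
  open RealField R
  open Arrangement R using (σIm)
  open IsStrictTotalOrder isStrictTotalOrder public
    using () renaming (trans to <-trans; irrefl to <-irrefl; asym to <-asym)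

  ring : CommutativeRing 0ℓ 0ℓ
  ring = record { isCommutativeRing = isCommutativeRing }

  open CommutativeRing ring public
    using (+-identityˡ; +-identityʳ; +-assoc; +-comm; -‿inverseˡ; -‿inverseʳ;
           *-assoc; *-comm; *-identityʳ; *-identityˡ; zeroˡ; zeroʳ; distribˡ; distribʳ;
           commutativeSemiring)
  open import Algebra.Properties.Ring (CommutativeRing.ring ring) public
    using (-‿distribˡ-*; -‿distribʳ-*; -0#≈0#; -1*x≈-x; -‿involutive; +-inverseˡ-unique)

  infix 4 _≟_
  _≟_ : ∀ x y → Dec (x ≡ y)
  _≟_ = IsStrictTotalOrder._≟_ isStrictTotalOrder

  z≡0⇒x+y*z≡x : ∀ {x y z} → z ≡ 0r → x + y * z ≡ x
  z≡0⇒x+y*z≡x {x} {y} z≡0 = trans (cong (λ u → x + y * u) z≡0) (trans (cong (x +_) (zeroʳ y)) (+-identityʳ x))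

  x*y≡0⇒x≡0 : ∀ {x y} → ¬ y ≡ 0r → x * y ≡ 0r → x ≡ 0r
  x*y≡0⇒x≡0 {x} {y} y≢0 xy≡0 with y⁻¹ , yy⁻¹≡1 ← inverse y y≢0 = begin
    x              ≡⟨ *-identityʳ x ⟨
    x * 1r         ≡⟨ cong (x *_) yy⁻¹≡1 ⟨
    x * (y * y⁻¹)  ≡⟨ *-assoc x y y⁻¹ ⟨
    x * y * y⁻¹    ≡⟨ cong (_* y⁻¹) xy≡0 ⟩
    0r * y⁻¹       ≡⟨ zeroˡ y⁻¹ ⟩
    0r             ∎
    where open ≡-Reasoning

  eliminate : ∀ a {b} → ¬ b ≡ 0r → ∃[ t ] a + t * b ≡ 0r
  eliminate a {b} b≢0 with b⁻¹ , bb⁻¹≡1 ← inverse b b≢0 = - a * b⁻¹ , (begin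
    a + - a * b⁻¹ * b    ≡⟨ cong (a +_) (*-assoc (- a) b⁻¹ b) ⟩
    a + - a * (b⁻¹ * b)  ≡⟨ cong (λ u → a + - a * u) (trans (*-comm b⁻¹ b) bb⁻¹≡1) ⟩
    a + - a * 1r         ≡⟨ cong (a +_) (*-identityʳ (- a)) ⟩
    a + - a              ≡⟨ -‿inverseʳ a ⟩
    0r                   ∎)
    where open ≡-Reasoning

  neg-pos : ∀ {x} → 0r < x → - x < 0r
  neg-pos {x} 0<x = subst₂ _<_ (+-identityˡ (- x)) (-‿inverseʳ x) (+-mono-< (- x) 0<x)

  neg-neg : ∀ {x} → x < 0r → 0r < - x
  neg-neg {x} x<0 = subst₂ _<_ (-‿inverseʳ x) (+-identityˡ (- x)) (+-mono-< (- x) x<0)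

  +-pos : ∀ {x y} → 0r < x → 0r < y → 0r < x + y
  +-pos {x} {y} 0<x 0<y = <-trans 0<y (subst (_< x + y) (+-identityˡ y) (+-mono-< y 0<x))

  +-neg : ∀ {x y} → x < 0r → y < 0r → x + y < 0r
  +-neg {x} {y} x<0 y<0 = <-trans (subst (x + y <_) (+-identityˡ y) (+-mono-< y x<0)) y<0

  -- A relational form of `σIm`: matching on it exposes the order witness without unfolding
  -- `compare`, and `sign-unique` leads back to equations between symbols.
  data Sign (x : ℝ) : Sym → Set where
    pos  : 0r < x → Sign x ⊕
    zero : x ≡ 0r → Sign x 𝟘
    neg  : x < 0r → Sign x ⊖

  sign-cong : ∀ {x y s} → x ≡ y → Sign x s → Sign y s
  sign-cong refl sx = sx

  sign : ∀ x → Sign x (σIm x)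
  sign x with compare 0r x
  ... | tri< 0<x _ _ = pos 0<x
  ... | tri≈ _ 0≡x _ = zero (sym 0≡x)
  ... | tri> _ _ x<0 = neg x<0

  sign-unique : ∀ {x s t} → Sign x s → Sign x t → s ≡ t
  sign-unique (pos _)    (pos _)    = refl
  sign-unique (pos 0<x)  (zero x≡0) = contradiction 0<x (<-irrefl (sym x≡0))
  sign-unique (pos 0<x)  (neg x<0)  = contradiction x<0 (<-asym 0<x)
  sign-unique (zero x≡0) (pos 0<x)  = contradiction 0<x (<-irrefl (sym x≡0))
  sign-unique (zero _)   (zero _)   = refl
  sign-unique (zero x≡0) (neg x<0)  = contradiction x<0 (<-irrefl x≡0)
  sign-unique (neg x<0)  (pos 0<x)  = contradiction x<0 (<-asym 0<x)
  sign-unique (neg x<0)  (zero x≡0) = contradiction x<0 (<-irrefl x≡0)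
  sign-unique (neg _)    (neg _)    = refl

  sign⇒σ : ∀ {x s} → Sign x s → σIm x ≡ s
  sign⇒σ = sign-unique (sign _)

  σ⇒sign : ∀ {x s} → σIm x ≡ s → Sign x s
  σ⇒sign {x} refl = sign x

  σ≡𝟘⇒≡0 : ∀ {x} → σIm x ≡ 𝟘 → x ≡ 0r
  σ≡𝟘⇒≡0 {x} σ≡𝟘 with zero x≡0 ← σ⇒sign {x} σ≡𝟘 = x≡0

  ≡0⇒σ≡𝟘 : ∀ {x} → x ≡ 0r → σIm x ≡ 𝟘
  ≡0⇒σ≡𝟘 x≡0 = sign⇒σ (zero x≡0)

  ≢0⇒σ≡± : ∀ {x} → ¬ x ≡ 0r → σIm x ≡ ⊕ ⊎ σIm x ≡ ⊖
  ≢0⇒σ≡± {x} x≢0 with σIm x in eq | sign x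
  ... | _ | pos _    = inj₁ refl
  ... | _ | zero x≡0 = contradiction x≡0 x≢0
  ... | _ | neg _    = inj₂ refl

  sign-neg : ∀ {x s} → Sign x s → Sign (- x) (negˢ s)
  sign-neg (pos 0<x)  = neg (neg-pos 0<x)
  sign-neg (zero x≡0) = zero (trans (cong -_ x≡0) -0#≈0#)
  sign-neg (neg x<0)  = pos (neg-neg x<0)

  sign-scale : ∀ {t x s} → 0r < t → Sign x s → Sign (t * x) s
  sign-scale 0<t (pos 0<x)      = pos (*-pos 0<t 0<x)
  sign-scale {t} _ (zero x≡0)   = zero (trans (cong (t *_) x≡0) (zeroʳ t))
  sign-scale {t} {x} 0<t (neg x<0) = neg (subst (_< 0r)
    (trans (cong -_ (sym (-‿distribʳ-* t x))) (-‿involutive (t * x)))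
    (neg-pos (*-pos 0<t (neg-neg x<0))))

  -- Summands without opposite signs cannot cancel, so the sum has the sign of any nonzero summand.
  sign-+ : ∀ {x y s t} → ¬ Opposite s t → Sign x s → Sign y t → Sign (x + y) (s ∘ˢ t)
  sign-+ _ (pos p)  (pos q)  = pos (+-pos p q)
  sign-+ _ (pos p)  (zero q) = sign-cong (sym (trans (cong (_ +_) q) (+-identityʳ _))) (pos p)
  sign-+ ¬o (pos _) (neg _)  = contradiction ⊕⊖ ¬o
  sign-+ _ (zero p) q        = subst₂ Sign (sym (trans (cong (_+ _) p) (+-identityˡ _))) (𝟘-∘ˢ q) q
    where
    𝟘-∘ˢ : ∀ {y t} → Sign y t → t ≡ 𝟘 ∘ˢ t
    𝟘-∘ˢ (pos _)  = refl
    𝟘-∘ˢ (zero _) = refl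
    𝟘-∘ˢ (neg _)  = refl
  sign-+ ¬o (neg _) (pos _)  = contradiction ⊖⊕ ¬o
  sign-+ _ (neg p)  (zero q) = sign-cong (sym (trans (cong (_ +_) q) (+-identityʳ _))) (neg p)
  sign-+ _ (neg p)  (neg q)  = neg (+-neg p q)

  sign-+≡0 : ∀ {x y s} → x + y ≡ 0r → Sign y s → Sign x (negˢ s)
  sign-+≡0 {x} {y} {s} x+y≡0 sy =
    sign-cong (sym (+-inverseˡ-unique x y x+y≡0)) (sign-neg sy)

  0<1 : 0r < 1r
  0<1 with compare 0r 1r
  ... | tri< 0<1 _ _ = 0<1
  ... | tri≈ _ 0≡1 _ = contradiction 0≡1 0≢1
  ... | tri> _ _ 1<0 = subst (0r <_)
    (trans (sym (-‿distribˡ-* 1r (- 1r))) (trans (cong -_ (*-identityˡ (- 1r))) (-‿involutive 1r)))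
    (*-pos (neg-neg 1<0) (neg-neg 1<0))

  half : ∀ {δ} → 0r < δ → ∃[ ε ] (0r < ε × ε < δ)
  half {δ} 0<δ with 2⁻¹ , e ← inverse (1r + 1r) (λ 2≡0 → <-irrefl (sym 2≡0) (+-pos 0<1 0<1)) = δ * 2⁻¹ , 0<ε ,
    subst₂ _<_ (+-identityˡ _) ε+ε≡δ (+-mono-< (δ * 2⁻¹) 0<ε)
    where
    open ≡-Reasoning
    0<2⁻¹ : 0r < 2⁻¹
    0<2⁻¹ with compare 0r 2⁻¹
    ... | tri< p _ _ = p
    ... | tri≈ _ p _ = contradiction (trans (sym (zeroʳ _)) (trans (cong ((1r + 1r) *_) p) e)) 0≢1
    -- A negative inverse of 2 would make 2 · 2⁻¹ = 1 negative.
    ... | tri> _ _ p with () ← sign-unique (sign-scale (+-pos 0<1 0<1) (neg p)) (pos (subst (0r <_) (sym e) 0<1))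
    0<ε : 0r < δ * 2⁻¹
    0<ε = *-pos 0<δ 0<2⁻¹
    ε+ε≡δ : δ * 2⁻¹ + δ * 2⁻¹ ≡ δ
    ε+ε≡δ = begin
      δ * 2⁻¹ + δ * 2⁻¹         ≡⟨ distribˡ δ 2⁻¹ 2⁻¹ ⟨
      δ * (2⁻¹ + 2⁻¹)           ≡⟨ cong (δ *_) (cong₂ _+_ (*-identityˡ 2⁻¹) (*-identityˡ 2⁻¹)) ⟨
      δ * (1r * 2⁻¹ + 1r * 2⁻¹) ≡⟨ cong (δ *_) (distribʳ 2⁻¹ 1r 1r) ⟨
      δ * ((1r + 1r) * 2⁻¹)     ≡⟨ cong (δ *_) e ⟩
      δ * 1r                    ≡⟨ *-identityʳ δ ⟩
      δ                         ∎

  opposite⇒≢0 : ∀ {x s t} → Opposite s t → Sign x t → ¬ x ≡ 0r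
  opposite⇒≢0 ⊕⊖ p x≡0 with () ← sign-unique p (zero x≡0)
  opposite⇒≢0 ⊖⊕ p x≡0 with () ← sign-unique p (zero x≡0)

  opposite⇒≢negˢ : ∀ {s t} → Opposite s t → ¬ s ≡ negˢ s
  opposite⇒≢negˢ ⊕⊖ ()
  opposite⇒≢negˢ ⊖⊕ ()

  opposite⇒negˢ : ∀ {s t} → Opposite s t → negˢ t ≡ s
  opposite⇒negˢ ⊕⊖ = refl
  opposite⇒negˢ ⊖⊕ = refl

  -- The zero -a/b of a + c b is positive because a and b have opposite signs. It bounds the
  -- perturbation in `perturb₁` and is the parameter in `elimination`.
  balance : ∀ {a b s t} → Opposite s t → Sign a s → Sign b t → ∃[ c ] (0r < c × a + c * b ≡ 0r)
  balance {a} {b} {s} {t} o sa sb with c , a+cb≡0 ← eliminate a (opposite⇒≢0 o sb) = c , 0<c , a+cb≡0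
    where
    0<c : 0r < c
    0<c with compare 0r c
    ... | tri< p _ _ = p
    ... | tri≈ _ refl _ = contradiction (trans (sym (trans (cong (a +_) (zeroˡ b)) (+-identityʳ a))) a+cb≡0)
                            (opposite⇒≢0 (opposite-sym o) sa)
    -- For c < 0 the product c b would have the sign of a, so a = -(c b) would have the opposite
    -- sign to itself.
    ... | tri> _ _ c<0 = contradiction (sign-unique sa
            (sign-+≡0 a+cb≡0 (subst₂ Sign
              (trans (cong -_ (sym (-‿distribˡ-* c b))) (-‿involutive (c * b)))
              (opposite⇒negˢ o) (sign-neg (sign-scale (neg-neg c<0) sb))))) (opposite⇒≢negˢ o)

  -- A whole interval (0, δ) is demanded rather than one value, so that finitely many conditions can
  -- be met by a common ε.
  Small : (ℝ → Set) → Set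
  Small P = ∃[ δ ] (0r < δ × (∀ ε → 0r < ε → ε < δ → P ε))

  small-all : ∀ {m} (P : Fin m → ℝ → Set) → (∀ e → Small (P e)) → Small (λ ε → ∀ e → P e ε)
  small-all {ℕ.zero} P _ = 1r , 0<1 , λ _ _ _ ()
  small-all {ℕ.suc m} P small
    with δ₁ , 0<δ₁ , p₁ ← small fzero
       | δ₂ , 0<δ₂ , p₂ ← small-all (λ e → P (fsuc e)) (λ e → small (fsuc e))
    with compare δ₁ δ₂
  ... | tri< δ₁<δ₂ _ _ = δ₁ , 0<δ₁ , λ where
    ε 0<ε ε<δ fzero → p₁ ε 0<ε ε<δ
    ε 0<ε ε<δ (fsuc e) → p₂ ε 0<ε (<-trans ε<δ δ₁<δ₂) e
  ... | tri≈ _ refl _ = δ₁ , 0<δ₁ , λ where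
    ε 0<ε ε<δ fzero → p₁ ε 0<ε ε<δ
    ε 0<ε ε<δ (fsuc e) → p₂ ε 0<ε ε<δ e
  ... | tri> _ _ δ₂<δ₁ = δ₂ , 0<δ₂ , λ where
    ε 0<ε ε<δ fzero → p₁ ε 0<ε (<-trans ε<δ δ₂<δ₁)
    ε 0<ε ε<δ (fsuc e) → p₂ ε 0<ε ε<δ e

  -- Without opposite signs every positive ε works and the bound 1 is arbitrary. With opposite signs
  -- let t be the zero of a + t b; for ε < t the value a + ε b = -(t - ε) b keeps the sign of a.
  perturb₁ : ∀ a b → Small (λ ε → Sign (a + ε * b) (σIm a ∘ˢ σIm b))
  perturb₁ a b with opposite? (σIm a) (σIm b)
  ... | no ¬o = 1r , 0<1 , λ ε 0<ε _ → sign-+ ¬o (sign a) (sign-scale 0<ε (sign b))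
  ... | yes o with t , 0<t , a+tb≡0 ← balance o (sign a) (sign b) = t , 0<t , λ ε _ ε<t →
    subst (Sign (a + ε * b)) (trans (opposite⇒negˢ o) (sym (∘ˢ-opposite o)))
      (sign-+≡0 (split ε) (sign-scale (0<t-ε ε ε<t) (sign b)))
    where
    open ≡-Reasoning
    0<t-ε : ∀ ε → ε < t → 0r < t + - ε
    0<t-ε ε ε<t = subst (_< t + - ε) (-‿inverseʳ ε) (+-mono-< (- ε) ε<t)
    split : ∀ ε → a + ε * b + (t + - ε) * b ≡ 0r
    split ε = begin
      a + ε * b + (t + - ε) * b    ≡⟨ +-assoc a _ _ ⟩
      a + (ε * b + (t + - ε) * b)  ≡⟨ cong (a +_) (distribʳ b ε (t + - ε)) ⟨
      a + (ε + (t + - ε)) * b      ≡⟨ cong (λ u → a + u * b) (trans (+-comm ε _) (+-assoc t (- ε) ε)) ⟩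
      a + (t + (- ε + ε)) * b      ≡⟨ cong (λ u → a + u * b) (trans (cong (t +_) (-‿inverseˡ ε)) (+-identityʳ t)) ⟩
      a + t * b                    ≡⟨ a+tb≡0 ⟩
      0r                           ∎

  perturb : ∀ {m} (a b : Fin m → ℝ) → ∃[ ε ] (0r < ε × ∀ e → Sign (a e + ε * b e) (σIm (a e) ∘ˢ σIm (b e)))
  perturb a b
    with δ , 0<δ , p ← small-all _ (λ e → perturb₁ (a e) (b e))
    with ε , 0<ε , ε<δ ← half 0<δ = ε , 0<ε , p ε 0<ε ε<δ

-- Matroids of linear forms

-- Identities are stated between values only, never between points or forms, which are functions in
-- the application. Combinations u + t v are all that elimination uses, and `zero?` is its base
-- case.
record DualPair (R : RealField) : Set₁ where
  open RealField R
  infixl 6 _+[_]_ _⊞[_]_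
  field
    Form Point : Set
    ⟪_,_⟫ : Form → Point → ℝ
    _+[_]_ : Point → ℝ → Point → Point
    _⊞[_]_ : Form → ℝ → Form → Form
    linearʳ : ∀ f u t v → ⟪ f , u +[ t ] v ⟫ ≡ ⟪ f , u ⟫ + t * ⟪ f , v ⟫
    linearˡ : ∀ f t g v → ⟪ f ⊞[ t ] g , v ⟫ ≡ ⟪ f , v ⟫ + t * ⟪ g , v ⟫
    origin : Point
    ⟪-,origin⟫ : ∀ f → ⟪ f , origin ⟫ ≡ 0r
    zero? : ∀ f → (∀ v → ⟪ f , v ⟫ ≡ 0r) ⊎ ∃[ v ] ¬ ⟪ f , v ⟫ ≡ 0r

module LinearMatroid (R : RealField) (D : DualPair R) {m : ℕ} (φ : Fin m → DualPair.Form D) where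
  open RealField R
  open Arrangement R using (σIm)
  open Signs R
  open DualPair D

  Ker : Subset m → Point → Set
  Ker X v = ∀ e → e ∈ X → ⟪ φ e , v ⟫ ≡ 0r

  -- The span of the forms in X, expressed by duality so that no coefficients have to be carried.
  Cl : Subset m → Fin m → Set
  Cl X e = ∀ v → Ker X v → ⟪ φ e , v ⟫ ≡ 0r

  Independent : Subset m → Set
  Independent X = ∀ e → e ∈ X → ¬ Cl (X - e) e

  combine-≡0 : ∀ f {u} t {v} → ⟪ f , u ⟫ ≡ 0r → ⟪ f , v ⟫ ≡ 0r → ⟪ f , u +[ t ] v ⟫ ≡ 0r
  combine-≡0 f {u} t {v} fu≡0 fv≡0 = trans (linearʳ f u t v) (trans (z≡0⇒x+y*z≡x fv≡0) fu≡0)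

  -- Gaussian elimination on the form f: if g is nonzero at w ∈ ker S, then f is replaced by
  -- f′ = f + s g with f′(w) = 0, which agrees with f on ker (g ∷ S).
  vanishes-or-escapes : (S : List (Fin m)) (f : Form) →
    (∀ v → (∀ e → e ∈ᴸ S → ⟪ φ e , v ⟫ ≡ 0r) → ⟪ f , v ⟫ ≡ 0r) ⊎
    ∃[ v ] ((∀ e → e ∈ᴸ S → ⟪ φ e , v ⟫ ≡ 0r) × ¬ ⟪ f , v ⟫ ≡ 0r)
  vanishes-or-escapes [] f with zero? f
  ... | inj₁ f≡0 = inj₁ (λ v _ → f≡0 v)
  ... | inj₂ (v , fv≢0) = inj₂ (v , (λ _ ()) , fv≢0)
  vanishes-or-escapes (g ∷ S) f with vanishes-or-escapes S (φ g)
  ... | inj₁ g∈clS with vanishes-or-escapes S f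
  ...   | inj₁ f∈clS = inj₁ (λ v v∈ker → f∈clS v (λ e → v∈ker e ∘ thereᴸ))
  ...   | inj₂ (v , v∈ker , fv≢0) = inj₂ (v , (λ where
          e (hereᴸ refl) → g∈clS v v∈ker
          e (thereᴸ e∈S) → v∈ker e e∈S) , fv≢0)
  vanishes-or-escapes (g ∷ S) f | inj₂ (w , w∈ker , gw≢0)
    with s , fw+sgw≡0 ← eliminate ⟪ f , w ⟫ gw≢0
    with f′w≡0 ← trans (linearˡ f s (φ g) w) fw+sgw≡0
    with vanishes-or-escapes S (f ⊞[ s ] φ g)
  ... | inj₁ f′∈clS = inj₁ λ v v∈ker →
        trans (sym (trans (linearˡ f s (φ g) v) (z≡0⇒x+y*z≡x (v∈ker g (hereᴸ refl)))))
              (f′∈clS v (λ e → v∈ker e ∘ thereᴸ))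
  ... | inj₂ (u , u∈ker , f′u≢0)
    with t , gu+tgw≡0 ← eliminate ⟪ φ g , u ⟫ gw≢0 = inj₂ (u′ , u′∈ker , fu′≢0)
    where
    u′ = u +[ t ] w
    gu′≡0 = trans (linearʳ (φ g) u t w) gu+tgw≡0
    u′∈ker : ∀ e → e ∈ᴸ g ∷ S → ⟪ φ e , u′ ⟫ ≡ 0r
    u′∈ker e (hereᴸ refl) = gu′≡0
    u′∈ker e (thereᴸ e∈S) = combine-≡0 (φ e) t (u∈ker e e∈S) (w∈ker e e∈S)
    fu′≢0 : ¬ ⟪ f , u′ ⟫ ≡ 0r
    fu′≢0 fu′≡0 = f′u≢0 (begin
      ⟪ f ⊞[ s ] φ g , u ⟫                                ≡⟨ z≡0⇒x+y*z≡x f′w≡0 ⟨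
      ⟪ f ⊞[ s ] φ g , u ⟫ + t * ⟪ f ⊞[ s ] φ g , w ⟫     ≡⟨ linearʳ _ u t w ⟨
      ⟪ f ⊞[ s ] φ g , u′ ⟫                               ≡⟨ linearˡ f s (φ g) u′ ⟩
      ⟪ f , u′ ⟫ + s * ⟪ φ g , u′ ⟫                       ≡⟨ z≡0⇒x+y*z≡x gu′≡0 ⟩
      ⟪ f , u′ ⟫                                          ≡⟨ fu′≡0 ⟩
      0r                                                  ∎)
      where open ≡-Reasoning

  -- Non-membership in the closure gets a positive witness. The disjunction makes closure decidable,
  -- which licenses the later uses of `decidable-stable`.
  cl-or-escape : ∀ X e → Cl X e ⊎ ∃[ v ] (Ker X v × ¬ ⟪ φ e , v ⟫ ≡ 0r)
  cl-or-escape X e with vanishes-or-escapes (filter (_∈? X) (allFin m)) (φ e)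
  ... | inj₁ e∈cl = inj₁ λ v v∈ker → e∈cl v (λ f f∈ → v∈ker f (proj₂ (∈-filter⁻ (_∈? X) {xs = allFin m} f∈)))
  ... | inj₂ (v , v∈ker , ev≢0) =
    inj₂ (v , (λ f f∈X → v∈ker f (∈-filter⁺ (_∈? X) (∈-allFin f) f∈X)) , ev≢0)

  cl? : ∀ X e → Dec (Cl X e)
  cl? X e with cl-or-escape X e
  ... | inj₁ e∈cl = yes e∈cl
  ... | inj₂ (v , v∈ker , ev≢0) = no λ e∈cl → ev≢0 (e∈cl v v∈ker)

  escape : ∀ {X e} → ¬ Cl X e → ∃[ v ] (Ker X v × ¬ ⟪ φ e , v ⟫ ≡ 0r)
  escape {X} {e} e∉cl with cl-or-escape X e
  ... | inj₁ e∈cl = contradiction e∈cl e∉cl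
  ... | inj₂ p = p

  cl-∈ : ∀ {X e} → e ∈ X → Cl X e
  cl-∈ e∈X v v∈ker = v∈ker _ e∈X

  cl-trans : ∀ {X Y} → (∀ e → e ∈ X → Cl Y e) → ∀ {e} → Cl X e → Cl Y e
  cl-trans X⊆clY e∈clX v v∈kerY = e∈clX v (λ f f∈X → X⊆clY f f∈X v v∈kerY)

  cl-mono : ∀ {X Y} → X ⊆ Y → ∀ {e} → Cl X e → Cl Y e
  cl-mono X⊆Y = cl-trans (λ _ e∈X → cl-∈ (X⊆Y e∈X))

  ker-∪ : ∀ {X e v} → Ker X v → ⟪ φ e , v ⟫ ≡ 0r → Ker (X ∪ ⁅ e ⁆) v
  ker-∪ = ∪-all

  -- Take w in ker X with φ_i(w) ≠ 0; then φ_j(w) ≠ 0 as well. For x in the kernel of X ∪ i, choose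
  -- t with φ_j(x + tw) = 0. Then φ_i vanishes at x + tw and at x, so t = 0 and φ_j(x) = 0.
  exchange : ∀ {X i j} → ¬ Cl X i → Cl (X ∪ ⁅ j ⁆) i → Cl (X ∪ ⁅ i ⁆) j
  exchange {X} {i} {j} i∉cl i∈cl x x∈ker
    with w , w∈ker , iw≢0 ← escape i∉cl
    with t , jx+tjw≡0 ← eliminate ⟪ φ j , x ⟫ (λ jw≡0 → iw≢0 (i∈cl w (ker-∪ w∈ker jw≡0))) =
      trans (sym (trans (cong (λ u → ⟪ φ j , x ⟫ + u * ⟪ φ j , w ⟫) t≡0)
                   (trans (cong (⟪ φ j , x ⟫ +_) (zeroˡ _)) (+-identityʳ _)))) jx+tjw≡0
    where
    x∈kerX : Ker X x
    x∈kerX e e∈X = x∈ker e (p⊆p∪q ⁅ i ⁆ e∈X)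
    ix≡0 : ⟪ φ i , x ⟫ ≡ 0r
    ix≡0 = x∈ker i (x∈p∪⁅x⁆ X i)
    x+tw∈ker : Ker (X ∪ ⁅ j ⁆) (x +[ t ] w)
    x+tw∈ker = ker-∪ (λ e e∈X → combine-≡0 (φ e) t (x∈kerX e e∈X) (w∈ker e e∈X))
                     (trans (linearʳ (φ j) x t w) jx+tjw≡0)
    t≡0 : t ≡ 0r
    t≡0 = x*y≡0⇒x≡0 iw≢0 (begin
      t * ⟪ φ i , w ⟫                ≡⟨ +-identityˡ _ ⟨
      0r + t * ⟪ φ i , w ⟫           ≡⟨ cong (_+ t * ⟪ φ i , w ⟫) ix≡0 ⟨
      ⟪ φ i , x ⟫ + t * ⟪ φ i , w ⟫  ≡⟨ linearʳ (φ i) x t w ⟨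
      ⟪ φ i , x +[ t ] w ⟫           ≡⟨ i∈cl _ x+tw∈ker ⟩
      0r                             ∎)
      where open ≡-Reasoning

  -- Independence, Steinitz exchange and bases

  independent-⊆ : ∀ {X Y} → X ⊆ Y → Independent Y → Independent X
  independent-⊆ {X} {Y} X⊆Y indep e e∈X e∈cl = indep e (X⊆Y e∈X) (cl-mono X-e⊆Y-e e∈cl)
    where
    X-e⊆Y-e : X - e ⊆ Y - e
    X-e⊆Y-e f∈ = x∈p∧x≢y⇒x∈p-y (X⊆Y (p-x⊆p X e f∈)) λ { refl → x∉p-x X e f∈ }

  independent-∪ : ∀ {X e} → Independent X → ¬ Cl X e → Independent (X ∪ ⁅ e ⁆)
  independent-∪ {X} {e} indep e∉cl f f∈ f∈cl with x∈p∪⁅y⁆⁻ X f∈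
  ... | inj₂ refl = e∉cl (cl-mono back f∈cl)
    where
    back : (X ∪ ⁅ e ⁆) - e ⊆ X
    back g∈ with x∈p∪⁅y⁆⁻ X (p-x⊆p (X ∪ ⁅ e ⁆) e g∈)
    ... | inj₁ g∈X = g∈X
    ... | inj₂ refl = contradiction g∈ (x∉p-x (X ∪ ⁅ e ⁆) e)
  -- Here f is spanned by X - f together with e but not by X - f alone, so exchange puts e into the
  -- span of X.
  ... | inj₁ f∈X = e∉cl (cl-mono restore (exchange (indep f f∈X) (cl-mono reorder f∈cl)))
    where
    reorder : (X ∪ ⁅ e ⁆) - f ⊆ (X - f) ∪ ⁅ e ⁆
    reorder g∈ with x∈p∪⁅y⁆⁻ X (p-x⊆p (X ∪ ⁅ e ⁆) f g∈)
    ... | inj₁ g∈X = p⊆p∪q ⁅ e ⁆ (x∈p∧x≢y⇒x∈p-y g∈X λ { refl → x∉p-x (X ∪ ⁅ e ⁆) f g∈ })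
    ... | inj₂ refl = x∈p∪⁅x⁆ (X - f) e
    restore : (X - f) ∪ ⁅ f ⁆ ⊆ X
    restore g∈ with x∈p∪⁅y⁆⁻ (X - f) g∈
    ... | inj₁ g∈X-f = p-x⊆p X f g∈X-f
    ... | inj₂ refl = f∈X

  independent-∪⁻ : ∀ {X e} → e ∉ X → Independent (X ∪ ⁅ e ⁆) → ¬ Cl X e
  independent-∪⁻ {X} {e} e∉X indep e∈cl = indep e (x∈p∪⁅x⁆ X e) (cl-mono X⊆ e∈cl)
    where
    X⊆ : X ⊆ (X ∪ ⁅ e ⁆) - e
    X⊆ f∈X = x∈p∧x≢y⇒x∈p-y (p⊆p∪q ⁅ e ⁆ f∈X) λ { refl → e∉X f∈X }

  independent-⊥ : Independent ⊥
  independent-⊥ _ e∈⊥ = contradiction e∈⊥ ∉⊥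

  outside-cl : ∀ {X Y e} → Cl X e → ¬ Cl Y e → ∃[ f ] (f ∈ X × ¬ Cl Y f)
  outside-cl {X} {Y} {e} e∈clX e∉clY with any? (λ f → (f ∈? X) ×-dec ¬? (cl? Y f))
  ... | yes p = p
  ... | no ¬p = contradiction (cl-trans X⊆clY e∈clX) e∉clY
    where
    X⊆clY : ∀ f → f ∈ X → Cl Y f
    X⊆clY f f∈X = decidable-stable (cl? Y f) λ f∉clY → ¬p (f , f∈X , f∉clY)

  -- Steinitz exchange: each element of X ─ Y is traded for one of Y, which shrinks X ─ Y.
  steinitz′ : ∀ k X Y → ∣ X ─ Y ∣ <ℕ k → Independent X → (∀ e → e ∈ X → Cl Y e) → ∣ X ∣ ≤ℕ ∣ Y ∣
  steinitz′ (ℕ.suc k) X Y (s≤s ∣X─Y∣≤k) indep X⊆clY with any? (λ i → (i ∈? X) ×-dec ¬? (i ∈? Y))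
  ... | no X⊆Y = p⊆q⇒∣p∣≤∣q∣ λ {i} i∈X → decidable-stable (i ∈? Y) λ i∉Y → X⊆Y (i , i∈X , i∉Y)
  ... | yes (i , i∈X , i∉Y) with j , j∈Y , j∉cl ← outside-cl {Y} {X - i} (X⊆clY i i∈X) (indep i i∈X) =
    ℕ.≤-trans ∣X∣≤∣X′∣ (steinitz′ k X′ Y (ℕ.<-≤-trans ∣X′─Y∣<∣X─Y∣ ∣X─Y∣≤k)
      (independent-∪ (independent-⊆ (p-x⊆p X i) indep) j∉cl) X′⊆clY)
    where
    X′ = (X - i) ∪ ⁅ j ⁆
    X′⊆clY : ∀ e → e ∈ X′ → Cl Y e
    X′⊆clY = ∪-all (λ e e∈X-i → X⊆clY e (p-x⊆p X i e∈X-i)) (cl-∈ j∈Y)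
    ∣X∣≤∣X′∣ : ∣ X ∣ ≤ℕ ∣ X′ ∣
    ∣X∣≤∣X′∣ = ℕ.≤-trans (∣p∣≤1+∣p-x∣ X i)
      (p⊂q⇒∣p∣<∣q∣ (p⊆p∪q ⁅ j ⁆ , j , x∈p∪⁅x⁆ (X - i) j , λ j∈X-i → j∉cl (cl-∈ j∈X-i)))
    X′─Y⊆X─Y : X′ ─ Y ⊆ X ─ Y
    X′─Y⊆X─Y e∈ with x∈p∪⁅y⁆⁻ (X - i) (p─q⊆p X′ Y e∈)
    ... | inj₁ e∈X-i = x∈p∧x∉q⇒x∈p─q (p-x⊆p X i e∈X-i) (x∈p─q⇒x∉q X′ Y e∈)
    ... | inj₂ refl = contradiction j∈Y (x∈p─q⇒x∉q X′ Y e∈)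
    i∉X′ : i ∉ X′
    i∉X′ i∈X′ with x∈p∪⁅y⁆⁻ (X - i) i∈X′
    ... | inj₁ i∈X-i = x∉p-x X i i∈X-i
    ... | inj₂ refl = i∉Y j∈Y
    ∣X′─Y∣<∣X─Y∣ : ∣ X′ ─ Y ∣ <ℕ ∣ X ─ Y ∣
    ∣X′─Y∣<∣X─Y∣ = p⊂q⇒∣p∣<∣q∣
      (X′─Y⊆X─Y , i , x∈p∧x∉q⇒x∈p─q i∈X i∉Y , λ i∈ → i∉X′ (p─q⊆p X′ Y i∈))

  steinitz : ∀ {X Y} → Independent X → (∀ e → e ∈ X → Cl Y e) → ∣ X ∣ ≤ℕ ∣ Y ∣
  steinitz {X} {Y} = steinitz′ _ X Y ℕ.≤-refl

  extend : (P : Fin m → Set) → (∀ e → Dec (P e)) → ∀ L {I} → Independent I → (∀ e → e ∈ I → P e) →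
    ∃[ B ] (Independent B × I ⊆ B × (∀ e → e ∈ B → P e) × (∀ e → e ∈ᴸ L → P e → Cl B e))
  extend P P? [] {I} indep I⊆P = I , indep , (λ e∈I → e∈I) , I⊆P , λ _ ()
  extend P P? (e ∷ L) {I} indep I⊆P with P? e | cl? I e
  ... | no ¬Pe | _
    with B , indepB , I⊆B , B⊆P , L⊆clB ← extend P P? L indep I⊆P = B , indepB , I⊆B , B⊆P , λ where
      f (hereᴸ refl) Pe → contradiction Pe ¬Pe
      f (thereᴸ f∈L) → L⊆clB f f∈L
  ... | yes _ | yes e∈clI
    with B , indepB , I⊆B , B⊆P , L⊆clB ← extend P P? L indep I⊆P = B , indepB , I⊆B , B⊆P , λ where
      f (hereᴸ refl) _ → cl-mono I⊆B e∈clI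
      f (thereᴸ f∈L) → L⊆clB f f∈L
  ... | yes Pe | no e∉clI
    with B , indepB , I∪e⊆B , B⊆P , L⊆clB ← extend P P? L (independent-∪ indep e∉clI) (∪-all I⊆P Pe) =
      B , indepB , (λ f∈I → I∪e⊆B (p⊆p∪q ⁅ e ⁆ f∈I)) , B⊆P , λ where
      f (hereᴸ refl) _ → cl-∈ (I∪e⊆B (x∈p∪⁅x⁆ I e))
      f (thereᴸ f∈L) → L⊆clB f f∈L

  -- The prescribed set I allows a basis to be forced through a given element, as `cl⇒ξ` requires.
  basis : (P : Fin m → Set) → (∀ e → Dec (P e)) → ∀ {I} → Independent I → (∀ e → e ∈ I → P e) →
    ∃[ B ] (Independent B × I ⊆ B × (∀ e → e ∈ B → P e) × (∀ e → P e → Cl B e))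
  basis P P? indep I⊆P with B , indepB , I⊆B , B⊆P , P⊆clB ← extend P P? (allFin m) indep I⊆P =
    B , indepB , I⊆B , B⊆P , λ e → P⊆clB e (∈-allFin e)

  -- Perturbation and generic points

  perturb-point : ∀ v w → ∃[ ε ] (0r < ε ×
    ∀ e → Sign ⟪ φ e , v +[ ε ] w ⟫ (σIm ⟪ φ e , v ⟫ ∘ˢ σIm ⟪ φ e , w ⟫))
  perturb-point v w with ε , 0<ε , sgn ← perturb (λ e → ⟪ φ e , v ⟫) (λ e → ⟪ φ e , w ⟫) =
    ε , 0<ε , λ e → sign-cong (sym (linearʳ (φ e) v ε w)) (sgn e)

  -- Perturbation creates no new zeros: a composed sign is 𝟘 only if both of its factors are.
  sign-∘ˢ-≡0 : ∀ {x a b} → Sign x (σIm a ∘ˢ σIm b) → x ≡ 0r → a ≡ 0r × b ≡ 0r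
  sign-∘ˢ-≡0 {x} {a} {b} sx x≡0
    with σa≡𝟘 , σb≡𝟘 ← ∘ˢ-𝟘 (σIm a) (σIm b) (sign-unique sx (zero x≡0)) =
    σ≡𝟘⇒≡0 σa≡𝟘 , σ≡𝟘⇒≡0 σb≡𝟘

  -- If φ_e is not yet avoided, push v slightly towards a point w of ker X where φ_e is nonzero; no
  -- form that was nonzero at v becomes zero.
  avoid : ∀ X L → ∃[ v ] (Ker X v × (∀ e → e ∈ᴸ L → ¬ Cl X e → ¬ ⟪ φ e , v ⟫ ≡ 0r))
  avoid X [] = origin , (λ e _ → ⟪-,origin⟫ (φ e)) , λ _ ()
  avoid X (e ∷ L) with v , v∈ker , v-generic ← avoid X L | cl-or-escape X e
  ... | inj₁ e∈cl = v , v∈ker , λ where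
    f (hereᴸ refl) f∉cl → contradiction e∈cl f∉cl
    f (thereᴸ f∈L) → v-generic f f∈L
  ... | inj₂ (w , w∈ker , ew≢0)
    with ε , _ , sgn ← perturb-point v w = v +[ ε ] w ,
      (λ f f∈X → combine-≡0 (φ f) ε (v∈ker f f∈X) (w∈ker f f∈X)) , λ where
      f (hereᴸ refl) _ fu≡0 → ew≢0 (proj₂ (sign-∘ˢ-≡0 (sgn f) fu≡0))
      f (thereᴸ f∈L) f∉cl fu≡0 → v-generic f f∈L f∉cl (proj₁ (sign-∘ˢ-≡0 (sgn f) fu≡0))

  generic : ∀ X → ∃[ v ] (Ker X v × (∀ e → ¬ Cl X e → ¬ ⟪ φ e , v ⟫ ≡ 0r))
  generic X with v , v∈ker , v-generic ← avoid X (allFin m) = v , v∈ker , λ e → v-generic e (∈-allFin e)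

-- Feasible sets and covectors

-- For the arrangement, dup (x + iy) = y + iy and prj (x + iy) = iy, so that φ_e ∘ dup = φ_ρ(e) and
-- prj forgets the coordinates seen by the H_i.
module FeasibleSets (R : RealField) (D : DualPair R) {m : ℕ} (φ : Fin m → DualPair.Form D)
  (ρ : Fin m → Fin m) (ρ-idem : ∀ e → ρ (ρ e) ≡ ρ e)
  (dup prj : DualPair.Point D → DualPair.Point D)
  (φ-dup : ∀ e v → DualPair.⟪_,_⟫ D (φ e) (dup v) ≡ DualPair.⟪_,_⟫ D (φ (ρ e)) v)
  (φ-prj-fixed : ∀ e v → ρ e ≡ e → DualPair.⟪_,_⟫ D (φ e) (prj v) ≡ DualPair.⟪_,_⟫ D (φ e) v)
  (φ-prj-moved : ∀ e v → ¬ ρ e ≡ e → DualPair.⟪_,_⟫ D (φ e) (prj v) ≡ RealField.0r R)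
  where

  open RealField R
  open Arrangement R using (σIm)
  open Signs R
  open DualPair D
  open LinearMatroid R D φ

  Feasible : Subset m → Set
  Feasible X = Independent X × (∀ e → e ∈ X → Cl X (ρ e))

  Extensible : Subset m → Fin m → Set
  Extensible X e = ¬ Cl X e × Cl (X ∪ ⁅ e ⁆) (ρ e)

  feasible-⊥ : Feasible ⊥
  feasible-⊥ = independent-⊥ , λ _ e∈⊥ → contradiction e∈⊥ ∉⊥

  -- For v in ker X, feasibility makes all φ_ρ(f) with f ∈ X vanish at v, so `dup v` is again in ker
  -- X; there φ_e takes the value φ_ρ(e)(v).
  cl-ρ : ∀ {X e} → Feasible X → Cl X e → Cl X (ρ e)
  cl-ρ {e = e} (_ , closed) e∈cl v v∈ker = trans (sym (φ-dup e v))
    (e∈cl (dup v) λ f f∈X → trans (φ-dup f v) (closed f f∈X v v∈ker))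

  -- Since ρ(e) is fixed by ρ, its form does not distinguish v from `prj v`, where the moved
  -- elements of X vanish automatically. Only the fixed elements of X matter.
  ρ-cl-trans : ∀ {X Y} → (∀ f → f ∈ X → ρ f ≡ f → Cl Y f) → ∀ {e} → Cl X (ρ e) → Cl Y (ρ e)
  ρ-cl-trans {X} X⊆clY {e} ρe∈cl v v∈ker =
    trans (sym (φ-prj-fixed (ρ e) v (ρ-idem e))) (ρe∈cl (prj v) prj∈ker)
    where
    prj∈ker : Ker X (prj v)
    prj∈ker f f∈X with ρ f ≟ᶠ f
    ... | yes ρf≡f = trans (φ-prj-fixed f v ρf≡f) (X⊆clY f f∈X ρf≡f v v∈ker)
    ... | no ρf≢f = φ-prj-moved f v ρf≢f

  extend-feasible : ∀ {X e} → Feasible X → Extensible X e → Feasible (X ∪ ⁅ e ⁆)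
  extend-feasible {X} {e} (indep , closed) (e∉cl , ρe∈cl) = independent-∪ indep e∉cl ,
    ∪-all (λ f f∈X → cl-mono (p⊆p∪q ⁅ e ⁆) (closed f f∈X)) ρe∈cl

  extensible : ∀ {X e} → e ∉ X → Feasible (X ∪ ⁅ e ⁆) → Extensible X e
  extensible {X} {e} e∉X (indep , closed) = independent-∪⁻ e∉X indep , closed e (x∈p∪⁅x⁆ X e)

  extensible-intro : ∀ {X e} → ¬ Cl X e → ρ e ≡ e ⊎ Cl X (ρ e) → Extensible X e
  extensible-intro {X} {e} e∉cl (inj₁ ρe≡e) =
    e∉cl , subst (Cl (X ∪ ⁅ e ⁆)) (sym ρe≡e) (cl-∈ (x∈p∪⁅x⁆ X e))
  extensible-intro {X} {e} e∉cl (inj₂ ρe∈cl) = e∉cl , cl-mono (p⊆p∪q ⁅ e ⁆) ρe∈cl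

  -- A moved e does not help to span ρ(e), so ρ(e) must be spanned by X already. Together with
  -- `extensible-intro` this shows that extensibility depends only on the closure of X.
  extensible-ρ : ∀ {X e} → Extensible X e → ρ e ≡ e ⊎ Cl X (ρ e)
  extensible-ρ {X} {e} (_ , ρe∈cl) with ρ e ≟ᶠ e
  ... | yes ρe≡e = inj₁ ρe≡e
  ... | no ρe≢e = inj₂ (ρ-cl-trans
    (∪-all (λ f f∈X _ → cl-∈ f∈X) (λ ρe≡e → contradiction ρe≡e ρe≢e)) ρe∈cl)

  -- Elements moved by ρ are removed first, since ρ-closedness only depends on the fixed ones.
  shrink : ∀ {X} → Feasible X → Nonempty X → ∃[ x ] (x ∈ X × Feasible (X - x) × Extensible (X - x) x)
  shrink {X} (indep , closed) (y , y∈X) = removable (any? (λ x → (x ∈? X) ×-dec ¬? (ρ x ≟ᶠ x)))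
    where
    remove : ∀ x → x ∈ X → (∀ f → f ∈ X - x → Cl (X - x) (ρ f)) →
      ∃[ x ] (x ∈ X × Feasible (X - x) × Extensible (X - x) x)
    remove x x∈X closed′ = x , x∈X , (independent-⊆ (p-x⊆p X x) indep , closed′) ,
      indep x x∈X , cl-mono (p⊆[p-x]∪⁅x⁆ X x) (closed x x∈X)
    removable : Dec (∃[ x ] (x ∈ X × ¬ ρ x ≡ x)) →
      ∃[ x ] (x ∈ X × Feasible (X - x) × Extensible (X - x) x)
    removable (yes (x , x∈X , ρx≢x)) = remove x x∈X λ f f∈ → ρ-cl-trans
      (λ g g∈X ρg≡g → cl-∈ (x∈p∧x≢y⇒x∈p-y g∈X λ { refl → ρx≢x ρg≡g })) (closed f (p-x⊆p X x f∈))
    removable (no fixed) = remove y y∈X λ f f∈ → subst (Cl (X - y))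
      (sym (decidable-stable (ρ f ≟ᶠ f) λ ρf≢f → fixed (f , p-x⊆p X y f∈ , ρf≢f))) (cl-∈ f∈)

  -- Steinitz gives e ∈ X outside cl(Y). If ρ(e) ∈ cl(Y), then e itself can be adjoined. Otherwise,
  -- as the fixed elements of X span ρ(e), one of them lies outside cl(Y), and a fixed element
  -- outside the closure can always be adjoined.
  augment : ∀ {X Y} → Feasible X → Feasible Y → ∣ Y ∣ <ℕ ∣ X ∣ → ∃[ x ] (x ∈ X × Extensible Y x)
  augment {X} {Y} (indep , closed) fY ∣Y∣<∣X∣ = choose (any? (λ e → (e ∈? X) ×-dec ¬? (cl? Y e)))
    where
    fixed-candidate : ∀ {e} → e ∈ X → ¬ Cl Y (ρ e) →
      Dec (∃[ f ] (f ∈ X × ρ f ≡ f × ¬ Cl Y f)) → ∃[ x ] (x ∈ X × Extensible Y x)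
    fixed-candidate _ _ (yes (f , f∈X , ρf≡f , f∉cl)) = f , f∈X , extensible-intro f∉cl (inj₁ ρf≡f)
    fixed-candidate {e} e∈X ρe∉cl (no none) = contradiction
      (ρ-cl-trans (λ f f∈X ρf≡f → decidable-stable (cl? Y f) λ f∉cl → none (f , f∈X , ρf≡f , f∉cl))
        (closed e e∈X)) ρe∉cl
    choose : Dec (∃[ e ] (e ∈ X × ¬ Cl Y e)) → ∃[ x ] (x ∈ X × Extensible Y x)
    choose (no none) = contradiction
      (steinitz indep λ e e∈X → decidable-stable (cl? Y e) λ e∉cl → none (e , e∈X , e∉cl)) (ℕ.<⇒≱ ∣Y∣<∣X∣)
    choose (yes (e , e∈X , e∉cl)) with cl? Y (ρ e)
    ... | yes ρe∈cl = e , e∈X , extensible-intro e∉cl (inj₂ ρe∈cl)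
    ... | no ρe∉cl = fixed-candidate e∈X ρe∉cl
            (any? (λ f → (f ∈? X) ×-dec ((ρ f ≟ᶠ f) ×-dec ¬? (cl? Y f))))

  -- In the arrangement this says that v lies on the subspace e; see `InE⇒null` and `null⇒InE`.
  Null : Point → Fin m → Set
  Null v e = ⟪ φ e , v ⟫ ≡ 0r × ⟪ φ (ρ e) , v ⟫ ≡ 0r

  null-intro : ∀ {v e} → ρ e ≡ e ⊎ ⟪ φ (ρ e) , v ⟫ ≡ 0r → ⟪ φ e , v ⟫ ≡ 0r → Null v e
  null-intro {v} (inj₁ ρe≡e) ev≡0 = ev≡0 , trans (cong (λ f → ⟪ φ f , v ⟫) ρe≡e) ev≡0
  null-intro (inj₂ ρev≡0) ev≡0 = ev≡0 , ρev≡0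

  null-ρ : ∀ {v e} → Null v e → Null v (ρ e)
  null-ρ {v} {e} (_ , ρev≡0) = null-intro (inj₁ (ρ-idem e)) ρev≡0

  cl⇒null : ∀ {X v e} → Feasible X → Ker X v → Cl X e → Null v e
  cl⇒null {v = v} fX v∈ker e∈cl = e∈cl v v∈ker , cl-ρ fX e∈cl v v∈ker

  -- The disjunction in `α-low`, called low below, marks the symbols that are honest signs. For H_i
  -- it says that ℓ_i(v) is real; for H_i^ℜ it always holds.
  module Oriented (φ≢0 : ∀ e → ∃[ v ] ¬ ⟪ φ e , v ⟫ ≡ 0r)
    (F : Subset m → Set) (F⇒feasible : ∀ {X} → F X → Feasible X) (feasible⇒F : ∀ {X} → Feasible X → F X)
    (α : Point → Fin m → Sym)
    (α-low : ∀ {e v} → ρ e ≡ e ⊎ ⟪ φ (ρ e) , v ⟫ ≡ 0r → α v e ≡ σIm ⟪ φ e , v ⟫)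
    (α-high : ∀ {e v} → ¬ ρ e ≡ e → ¬ ⟪ φ (ρ e) , v ⟫ ≡ 0r → α v e ≡ 𝟙)
    where

    open Greedoid F

    isIntervalGreedoid : IsIntervalGreedoid
    isIntervalGreedoid =
        (⊥ , feasible⇒F feasible-⊥)
      , (λ X FX X≢∅ → let x , x∈X , fX-x , _ = shrink (F⇒feasible FX) X≢∅ in x , x∈X , feasible⇒F fX-x)
      , (λ X Y FX FY ∣Y∣<∣X∣ →
          let x , x∈X , ext = augment (F⇒feasible FX) (F⇒feasible FY) ∣Y∣<∣X∣ in
          x , x∈X , (λ x∈Y → proj₁ ext (cl-∈ x∈Y)) , feasible⇒F (extend-feasible (F⇒feasible FY) ext))
      -- The condition e ∉ cl(Y) descends from Z, while ρ(e) ∈ cl(Y ∪ e) ascends from X.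
      , λ X Y Z e FX FY FZ X⊆Y Y⊆Z e∉Z FX∪e FZ∪e →
          let e∉clZ , _ = extensible e∉Z (F⇒feasible FZ∪e)
              _ , ρe∈clX∪e = extensible (e∉Z ∘ Y⊆Z ∘ X⊆Y) (F⇒feasible FX∪e) in
          feasible⇒F (extend-feasible (F⇒feasible FY)
            ( (λ e∈clY → e∉clZ (cl-mono Y⊆Z e∈clY))
            , cl-trans (∪-all (λ f f∈X → cl-∈ (p⊆p∪q ⁅ e ⁆ (X⊆Y f∈X))) (cl-∈ (x∈p∪⁅x⁆ Y e))) ρe∈clX∪e))

    Γ⇒extensible : ∀ {X e} → Γ X e → Extensible X e
    Γ⇒extensible (e∉X , FX∪e) = extensible e∉X (F⇒feasible FX∪e)

    extensible⇒Γ : ∀ {X e} → F X → Extensible X e → Γ X e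
    extensible⇒Γ FX ext = (λ e∈X → proj₁ ext (cl-∈ e∈X)) , feasible⇒F (extend-feasible (F⇒feasible FX) ext)

    -- An f in cl(X) but outside cl(Y) that could be adjoined to Y would lie in Γ(Y) = Γ(X),
    -- contradicting f ∈ cl(X). This applies first to ρ(e), which is fixed, and then to e, because
    -- ρ(e) ∈ cl(Y) is known by then.
    ∼⇒cl : ∀ {X Y e} → F X → F Y → X ∼ Y → Cl X e → Cl Y e
    ∼⇒cl {X} {Y} {e} FX FY X∼Y e∈clX =
      inherit e∈clX (inj₂ (inherit (cl-ρ (F⇒feasible FX) e∈clX) (inj₁ (ρ-idem e))))
      where
      inherit : ∀ {f} → Cl X f → ρ f ≡ f ⊎ Cl Y (ρ f) → Cl Y f
      inherit {f} f∈clX ρf = decidable-stable (cl? Y f) λ f∉clY →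
        proj₁ (Γ⇒extensible (proj₂ (X∼Y f) (extensible⇒Γ FY (extensible-intro f∉clY ρf)))) f∈clX

    cl⇒∼ : ∀ {X Y} → F X → F Y → (∀ {e} → Cl X e → Cl Y e) → (∀ {e} → Cl Y e → Cl X e) → X ∼ Y
    cl⇒∼ {X} {Y} FX FY X≤Y Y≤X e =
        (λ e∈ΓX → extensible⇒Γ FY (transport Y≤X X≤Y (Γ⇒extensible e∈ΓX)))
      , (λ e∈ΓY → extensible⇒Γ FX (transport X≤Y Y≤X (Γ⇒extensible e∈ΓY)))
      where
      transport : ∀ {X Y} → (∀ {e} → Cl Y e → Cl X e) → (∀ {e} → Cl X e → Cl Y e) →
        Extensible X e → Extensible Y e
      transport {X} {Y} Y≤X X≤Y (e∉cl , ρe∈cl) = (e∉cl ∘ Y≤X) ,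
        cl-trans (∪-all (λ f f∈X → cl-mono (p⊆p∪q ⁅ e ⁆) (X≤Y (cl-∈ f∈X))) (cl-∈ (x∈p∪⁅x⁆ Y e))) ρe∈cl

    ξ⇒cl : ∀ {X e} → F X → ξ X e → Cl X e
    ξ⇒cl FX (X′ , FX′ , X′∼X , e∈X′) = ∼⇒cl FX′ FX X′∼X (cl-∈ e∈X′)

    -- As φ_e is nonzero, the singleton of e is independent and extends to a basis of cl(X).
    -- Stability of cl(X) under ρ makes that basis feasible, so it is an equivalent set containing
    -- e.
    cl⇒ξ : ∀ {X e} → F X → Cl X e → ξ X e
    cl⇒ξ {X} {e} FX e∈clX
      with B , indepB , e⊆B , B⊆clX , clX⊆clB ← basis (Cl X) (cl? X)
             (independent-∪ {e = e} independent-⊥ λ e∈cl⊥ →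
               let v , ev≢0 = φ≢0 e in ev≢0 (e∈cl⊥ v λ _ f∈⊥ → contradiction f∈⊥ ∉⊥))
             (∪-all (λ _ f∈⊥ → contradiction f∈⊥ ∉⊥) e∈clX) =
      let FB = feasible⇒F (indepB , λ f f∈B → clX⊆clB (ρ f) (cl-ρ (F⇒feasible FX) (B⊆clX f f∈B))) in
      B , FB , cl⇒∼ FB FX (cl-trans B⊆clX) (clX⊆clB _) , e⊆B (x∈p∪⁅x⁆ ⊥ e)

    null? : ∀ v e → Dec (Null v e)
    null? v e = (⟪ φ e , v ⟫ ≟ 0r) ×-dec (⟪ φ (ρ e) , v ⟫ ≟ 0r)

    low? : ∀ v e → Dec (ρ e ≡ e ⊎ ⟪ φ (ρ e) , v ⟫ ≡ 0r)
    low? v e = (ρ e ≟ᶠ e) ⊎-dec (⟪ φ (ρ e) , v ⟫ ≟ 0r)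

    ≢𝟙⇒low : ∀ {v e} → ¬ α v e ≡ 𝟙 → ρ e ≡ e ⊎ ⟪ φ (ρ e) , v ⟫ ≡ 0r
    ≢𝟙⇒low {v} {e} α≢𝟙 = decidable-stable (low? v e) λ ¬low →
      α≢𝟙 (α-high (¬low ∘ inj₁) (¬low ∘ inj₂))

    null⇒α≡𝟘 : ∀ {v e} → Null v e → α v e ≡ 𝟘
    null⇒α≡𝟘 (ev≡0 , ρev≡0) = trans (α-low (inj₂ ρev≡0)) (≡0⇒σ≡𝟘 ev≡0)

    α≡𝟘⇒null : ∀ {v e} → α v e ≡ 𝟘 → Null v e
    α≡𝟘⇒null {v} {e} α≡𝟘 = null-intro low (σ≡𝟘⇒≡0 (trans (sym (α-low low)) α≡𝟘))
      where
      low : ρ e ≡ e ⊎ ⟪ φ (ρ e) , v ⟫ ≡ 0r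
      low = ≢𝟙⇒low λ α≡𝟙 → case trans (sym α≡𝟘) α≡𝟙 of λ ()

    -- The hypotheses on v say together that cl(X) is exactly its null set.
    covectorAt : ∀ {X v a} → F X → Ker X v → (∀ e → Null v e → Cl X e) → (∀ e → a e ≡ α v e) →
      CovectorAt X a
    covectorAt {X} {v} {a} FX v∈ker null⇒cl a≗α = FX , λ e → on-Γ e , on-ξ e , elsewhere e
      where
      on-Γ : ∀ e → Γ X e → a e ≡ ⊕ ⊎ a e ≡ ⊖
      on-Γ e e∈Γ with e∉cl , _ ← Γ⇒extensible e∈Γ =
        subst (λ s → s ≡ ⊕ ⊎ s ≡ ⊖) (sym (trans (a≗α e) (α-low low)))
          (≢0⇒σ≡± λ ev≡0 → e∉cl (null⇒cl e (null-intro low ev≡0)))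
        where
        low : ρ e ≡ e ⊎ ⟪ φ (ρ e) , v ⟫ ≡ 0r
        low with extensible-ρ (Γ⇒extensible e∈Γ)
        ... | inj₁ ρe≡e = inj₁ ρe≡e
        ... | inj₂ ρe∈cl = inj₂ (ρe∈cl v v∈ker)
      on-ξ : ∀ e → ξ X e → a e ≡ 𝟘
      on-ξ e e∈ξ with e∈cl ← ξ⇒cl FX e∈ξ =
        trans (a≗α e) (null⇒α≡𝟘 (cl⇒null (F⇒feasible FX) v∈ker e∈cl))
      elsewhere : ∀ e → ¬ Γ X e → ¬ ξ X e → a e ≡ 𝟙
      elsewhere e e∉Γ e∉ξ = trans (a≗α e) (α-high
        (λ ρe≡e → inextensible (inj₁ ρe≡e))
        (λ ρev≡0 → inextensible (inj₂ (null⇒cl (ρ e) (null-intro (inj₁ (ρ-idem e)) ρev≡0)))))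
        where
        inextensible : ¬ (ρ e ≡ e ⊎ Cl X (ρ e))
        inextensible = e∉Γ ∘ extensible⇒Γ FX ∘ extensible-intro (e∉ξ ∘ cl⇒ξ FX)

    ξ⇒null : ∀ {X v a e} → CovectorAt X a → (∀ e → a e ≡ α v e) → ξ X e → Null v e
    ξ⇒null {e = e} (_ , cov) a≗α e∈ξ = α≡𝟘⇒null (trans (sym (a≗α e)) (proj₁ (proj₂ (cov e)) e∈ξ))

    -- The representatives of supports in `IsProduct` are arbitrary. Since 𝟘 occurs only on ξ, each
    -- of them has the null set of its point as ξ.
    null⇒ξ : ∀ {X v a e} → CovectorAt X a → (∀ e → a e ≡ α v e) → Null v e → ξ X e
    null⇒ξ {X} {v} {a} {e} (FX , cov) a≗α null with cl? X e
    ... | yes e∈cl = cl⇒ξ FX e∈cl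
    ... | no e∉cl = case trans (sym a≡𝟘) (proj₂ (proj₂ (cov e)) e∉Γ (e∉cl ∘ ξ⇒cl FX)) of λ ()
      where
      a≡𝟘 : a e ≡ 𝟘
      a≡𝟘 = trans (a≗α e) (null⇒α≡𝟘 null)
      e∉Γ : ¬ Γ X e
      e∉Γ e∈Γ with proj₁ (cov e) e∈Γ
      ... | inj₁ a≡⊕ = case trans (sym a≡𝟘) a≡⊕ of λ ()
      ... | inj₂ a≡⊖ = case trans (sym a≡𝟘) a≡⊖ of λ ()

    -- The elements of Γ(C) ∪ ξ(C), where C = supp α_v ∨ supp α_w.
    CommonLow : Point → Point → Fin m → Set
    CommonLow v w e = ρ e ≡ e ⊎ (⟪ φ (ρ e) , v ⟫ ≡ 0r × ⟪ φ (ρ e) , w ⟫ ≡ 0r)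

    commonLow? : ∀ v w e → Dec (CommonLow v w e)
    commonLow? v w e = (ρ e ≟ᶠ e) ⊎-dec ((⟪ φ (ρ e) , v ⟫ ≟ 0r) ×-dec (⟪ φ (ρ e) , w ⟫ ≟ 0r))

    commonLowˡ : ∀ {v w e} → CommonLow v w e → ρ e ≡ e ⊎ ⟪ φ (ρ e) , v ⟫ ≡ 0r
    commonLowˡ = map₂ proj₁

    commonLowʳ : ∀ {v w e} → CommonLow v w e → ρ e ≡ e ⊎ ⟪ φ (ρ e) , w ⟫ ≡ 0r
    commonLowʳ = map₂ proj₂

    combine-low : ∀ {v w e} t → CommonLow v w e → ρ e ≡ e ⊎ ⟪ φ (ρ e) , v +[ t ] w ⟫ ≡ 0r
    combine-low {e = e} t = map₂ λ (v≡0 , w≡0) → combine-≡0 (φ (ρ e)) t v≡0 w≡0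

    -- Removes the join from the product: as `XC` is a maximal feasible set of common nulls,
    -- membership in Γ(C) ∪ ξ(C) becomes a condition on the values at v and w.
    product-spec : ∀ {v w a b c} → (∀ e → a e ≡ α v e) → (∀ e → b e ≡ α w e) → IsProduct a b c →
      ∀ e → (CommonLow v w e → c e ≡ σIm ⟪ φ e , v ⟫ ∘ˢ σIm ⟪ φ e , w ⟫) × (¬ CommonLow v w e → c e ≡ 𝟙)
    product-spec {v} {w} {a} {b} {c} a≗α b≗α (XA , XB , XC , covA , covB , (FC , C⊆ , C-max) , spec) e =
        (λ low → trans (proj₁ (spec e) (low⇒Γ⊎ξ low)) (cong₂ _∘ˢ_
          (trans (a≗α e) (α-low (commonLowˡ low))) (trans (b≗α e) (α-low (commonLowʳ low)))))
      , (λ ¬low → proj₂ (spec e) (¬low ∘ Γ⊎ξ⇒low))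
      where
      v∈ker : Ker XC v
      v∈ker f f∈C = proj₁ (ξ⇒null covA a≗α (proj₁ (C⊆ f f∈C)))
      w∈ker : Ker XC w
      w∈ker f f∈C = proj₁ (ξ⇒null covB b≗α (proj₂ (C⊆ f f∈C)))
      -- Maximality of `XC` absorbs any common null that could be adjoined. It is applied to ρ(e),
      -- which is fixed.
      grow : ∀ {f} → Null v f → Null w f → ρ f ≡ f ⊎ Cl XC (ρ f) → Cl XC f
      grow {f} nv nw ρf = decidable-stable (cl? XC f) λ f∉cl → f∉cl (cl-∈ (C-max (XC ∪ ⁅ f ⁆)
        (feasible⇒F (extend-feasible (F⇒feasible FC) (extensible-intro f∉cl ρf)))
        (p⊆p∪q ⁅ f ⁆)
        (∪-all C⊆ (null⇒ξ covA a≗α nv , null⇒ξ covB b≗α nw))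
        (x∈p∪⁅x⁆ XC f)))
      low⇒Γ⊎ξ : CommonLow v w e → Γ XC e ⊎ ξ XC e
      low⇒Γ⊎ξ low with cl? XC e
      ... | yes e∈cl = inj₂ (cl⇒ξ FC e∈cl)
      ... | no e∉cl = inj₁ (extensible⇒Γ FC (extensible-intro e∉cl (map₂ (λ (v≡0 , w≡0) →
              grow (null-intro (inj₁ (ρ-idem e)) v≡0) (null-intro (inj₁ (ρ-idem e)) w≡0) (inj₁ (ρ-idem e))) low)))
      cl⇒low : Cl XC (ρ e) → CommonLow v w e
      cl⇒low ρe∈cl = inj₂ (ρe∈cl v v∈ker , ρe∈cl w w∈ker)
      Γ⊎ξ⇒low : Γ XC e ⊎ ξ XC e → CommonLow v w e
      Γ⊎ξ⇒low (inj₁ e∈Γ) with extensible-ρ (Γ⇒extensible e∈Γ)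
      ... | inj₁ ρe≡e = inj₁ ρe≡e
      ... | inj₂ ρe∈cl = cl⇒low ρe∈cl
      Γ⊎ξ⇒low (inj₂ e∈ξ) = cl⇒low (cl-ρ (F⇒feasible FC) (ξ⇒cl FC e∈ξ))

    -- The axioms for the sign vectors of points

    L : (Fin m → Sym) → Set
    L a = ∃[ v ] (∀ e → a e ≡ α v e)

    covector : ∀ a → L a → Covector a
    covector a (v , a≗α)
      with B , indepB , _ , B⊆null , null⊆clB ← basis (Null v) (null? v) independent-⊥
             (λ _ e∈⊥ → contradiction e∈⊥ ∉⊥) =
      B , covectorAt (feasible⇒F (indepB , λ f f∈B → null⊆clB (ρ f) (null-ρ (B⊆null f f∈B))))
            (λ f f∈B → proj₁ (B⊆null f f∈B)) null⊆clB a≗α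

    supp-surjective : ∀ X → F X → ∃[ a ] (L a × CovectorAt X a)
    supp-surjective X FX with v , v∈ker , v-generic ← generic X = α v , (v , λ _ → refl) ,
      covectorAt FX v∈ker (λ e (ev≡0 , _) → decidable-stable (cl? X e) λ e∉cl → v-generic e e∉cl ev≡0) (λ _ → refl)

    negation-closed : ∀ a → L a → L (λ e → negˢ (a e))
    negation-closed a (v , a≗α) = -v , λ e → trans (cong negˢ (a≗α e)) (α-neg e)
      where
      -v = origin +[ - 1r ] v
      φ-neg : ∀ e → ⟪ φ e , -v ⟫ ≡ - ⟪ φ e , v ⟫
      φ-neg e = begin
        ⟪ φ e , -v ⟫                               ≡⟨ linearʳ (φ e) origin (- 1r) v ⟩
        ⟪ φ e , origin ⟫ + - 1r * ⟪ φ e , v ⟫      ≡⟨ cong₂ _+_ (⟪-,origin⟫ (φ e)) (-1*x≈-x _) ⟩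
        0r + - ⟪ φ e , v ⟫                         ≡⟨ +-identityˡ _ ⟩
        - ⟪ φ e , v ⟫                              ∎
        where open ≡-Reasoning
      φ-neg-≡0 : ∀ e → ⟪ φ e , -v ⟫ ≡ 0r → ⟪ φ e , v ⟫ ≡ 0r
      φ-neg-≡0 e -ev≡0 = trans (sym (-‿involutive _))
        (trans (cong -_ (trans (sym (φ-neg e)) -ev≡0)) -0#≈0#)
      α-neg : ∀ e → negˢ (α v e) ≡ α -v e
      α-neg e with low? v e
      ... | yes low = trans (cong negˢ (α-low low)) (sym (trans
              (α-low (map₂ (λ ρev≡0 → combine-≡0 (φ (ρ e)) (- 1r) (⟪-,origin⟫ _) ρev≡0) low))
              (sign⇒σ (sign-cong (sym (φ-neg e)) (sign-neg (sign _))))))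
      ... | no ¬low = trans (cong negˢ (α-high (¬low ∘ inj₁) (¬low ∘ inj₂)))
              (sym (α-high (¬low ∘ inj₁) (¬low ∘ inj₂ ∘ φ-neg-≡0 (ρ e))))

    product-closed : ∀ a b c → L a → L b → IsProduct a b c → L c
    product-closed a b c (v , a≗α) (w , b≗α) prod
      with ε , _ , sgn ← perturb-point v w = v +[ ε ] w , c≗α
      where
      c≗α : ∀ e → c e ≡ α (v +[ ε ] w) e
      c≗α e with commonLow? v w e
      ... | yes low = trans (proj₁ (product-spec a≗α b≗α prod e) low)
              (sym (trans (α-low (combine-low ε low)) (sign⇒σ (sgn e))))
      -- If φ_ρ(e) vanished at v + εw, it would vanish at v and at w, making e low at both.
      ... | no ¬low = trans (proj₂ (product-spec a≗α b≗α prod e) ¬low)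
              (sym (α-high (¬low ∘ inj₁) (¬low ∘ inj₂ ∘ sign-∘ˢ-≡0 (sgn (ρ e)))))

    -- Since the product at x is not 𝟙, x is low at both points, so the separation of symbols is a
    -- separation of the real values φ_x(v) and φ_x(w), and `balance` applies.
    elimination : ∀ a b ab ba x → L a → L b → IsProduct a b ab → IsProduct b a ba →
      Sep a b x → ¬ (ab x ≡ 𝟙) →
      ∃[ c ] (L c × c x ≡ 𝟘 × (∀ y → ¬ Sep a b y → ¬ (ab y ≡ 𝟙) → (c y ≡ ab y × c y ≡ ba y)))
    elimination a b ab ba x (v , a≗α) (w , b≗α) ab-prod ba-prod x∈sep ab≢𝟙
      with low ← decidable-stable (commonLow? v w x) (ab≢𝟙 ∘ proj₂ (product-spec a≗α b≗α ab-prod x))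
      with t , 0<t , xv+txw≡0 ← balance
             (subst₂ Opposite (trans (a≗α x) (α-low (commonLowˡ low))) (trans (b≗α x) (α-low (commonLowʳ low)))
               (±⇒opposite x∈sep))
             (sign ⟪ φ x , v ⟫) (sign ⟪ φ x , w ⟫) =
        α u , (u , λ _ → refl) ,
        trans (α-low (combine-low t low)) (≡0⇒σ≡𝟘 (trans (linearʳ (φ x) v t w) xv+txw≡0)) ,
        off-sep
      where
      u = v +[ t ] w
      -- Here t need not be small: y is low at both points and its signs are not opposite, so v + tw
      -- has the composed sign for every t > 0, in either order.
      off-sep : ∀ y → ¬ Sep a b y → ¬ (ab y ≡ 𝟙) → (α u y ≡ ab y × α u y ≡ ba y)
      off-sep y y∉sep ab≢𝟙 =
          trans α≡ (trans (sign⇒σ sgn) (sym (proj₁ (product-spec a≗α b≗α ab-prod y) low-y)))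
        , trans α≡ (trans (sign⇒σ sgn′) (sym (proj₁ (product-spec b≗α a≗α ba-prod y) (map₂ swap low-y))))
        where
        low-y : CommonLow v w y
        low-y = decidable-stable (commonLow? v w y) (ab≢𝟙 ∘ proj₂ (product-spec a≗α b≗α ab-prod y))
        ¬opposite : ¬ Opposite (σIm ⟪ φ y , v ⟫) (σIm ⟪ φ y , w ⟫)
        ¬opposite o = y∉sep (opposite⇒± (subst₂ Opposite
          (sym (trans (a≗α y) (α-low (commonLowˡ low-y)))) (sym (trans (b≗α y) (α-low (commonLowʳ low-y)))) o))
        α≡ : α u y ≡ σIm ⟪ φ y , u ⟫
        α≡ = α-low (combine-low t low-y)
        sgn : Sign ⟪ φ y , u ⟫ (σIm ⟪ φ y , v ⟫ ∘ˢ σIm ⟪ φ y , w ⟫)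
        sgn = sign-cong (sym (linearʳ (φ y) v t w))
          (sign-+ ¬opposite (sign _) (sign-scale 0<t (sign _)))
        sgn′ : Sign ⟪ φ y , u ⟫ (σIm ⟪ φ y , w ⟫ ∘ˢ σIm ⟪ φ y , v ⟫)
        sgn′ = sign-cong (trans (+-comm _ _) (sym (linearʳ (φ y) v t w)))
          (sign-+ (¬opposite ∘ opposite-sym) (sign-scale 0<t (sign _)) (sign _))

    isOrientedIntervalGreedoid : IsOrientedIntervalGreedoid L
    isOrientedIntervalGreedoid =
      isIntervalGreedoid , covector , supp-surjective , negation-closed , product-closed , elimination

-- The complexified arrangement

module Complexified (R : RealField) (d : ℕ) where
  open RealField R
  open Arrangement R
  open Signs R
  open SemiringSolver commutativeSemiring using (solve; _:=_; _:+_; _:*_)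

  combine : ∀ {k} → (Fin k → ℝ) → ℝ → (Fin k → ℝ) → Fin k → ℝ
  combine x t y j = x j + t * y j

  0ᵥ : ∀ {k} → Fin k → ℝ
  0ᵥ _ = 0r

  unit : ∀ {k} → Fin k → Fin k → ℝ
  unit fzero    fzero    = 1r
  unit fzero    (fsuc _) = 0r
  unit (fsuc _) fzero    = 0r
  unit (fsuc i) (fsuc j) = unit i j

  lin-comm : ∀ {k} (c x : Fin k → ℝ) → lin c x ≡ lin x c
  lin-comm {ℕ.zero} c x = refl
  lin-comm {ℕ.suc k} c x = cong₂ _+_ (*-comm _ _) (lin-comm (c ∘ fsuc) (x ∘ fsuc))

  lin-combineʳ : ∀ {k} (c x : Fin k → ℝ) t y → lin c (combine x t y) ≡ lin c x + t * lin c y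
  lin-combineʳ {ℕ.zero} c x t y = sym (z≡0⇒x+y*z≡x refl)
  lin-combineʳ {ℕ.suc k} c x t y = trans
    (cong (c fzero * (x fzero + t * y fzero) +_) (lin-combineʳ (c ∘ fsuc) (x ∘ fsuc) t (y ∘ fsuc)))
    (solve 6 (λ c x t y A B → c :* (x :+ t :* y) :+ (A :+ t :* B) := (c :* x :+ A) :+ t :* (c :* y :+ B))
      refl (c fzero) (x fzero) t (y fzero) (lin (c ∘ fsuc) (x ∘ fsuc)) (lin (c ∘ fsuc) (y ∘ fsuc)))

  lin-combineˡ : ∀ {k} (c : Fin k → ℝ) t c′ x → lin (combine c t c′) x ≡ lin c x + t * lin c′ x
  lin-combineˡ c t c′ x = trans (lin-comm (combine c t c′) x) (trans (lin-combineʳ x c t c′)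
    (cong₂ (λ a b → a + t * b) (lin-comm x c) (lin-comm x c′)))

  lin-0ˡ : ∀ {k} (c : Fin k → ℝ) x → (∀ j → c j ≡ 0r) → lin c x ≡ 0r
  lin-0ˡ {ℕ.zero} c x c≡0 = refl
  lin-0ˡ {ℕ.suc k} c x c≡0 = trans
    (cong₂ _+_ (trans (cong (_* x fzero) (c≡0 fzero)) (zeroˡ _)) (lin-0ˡ (c ∘ fsuc) (x ∘ fsuc) (c≡0 ∘ fsuc)))
    (+-identityˡ 0r)

  lin-0ʳ : ∀ {k} (c : Fin k → ℝ) → lin c 0ᵥ ≡ 0r
  lin-0ʳ c = trans (lin-comm c 0ᵥ) (lin-0ˡ 0ᵥ c λ _ → refl)

  lin-unit : ∀ {k} (c : Fin k → ℝ) i → lin c (unit i) ≡ c i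
  lin-unit c fzero = trans (cong₂ _+_ (*-identityʳ _) (lin-0ʳ (c ∘ fsuc))) (+-identityʳ _)
  lin-unit c (fsuc i) = trans (cong₂ _+_ (zeroʳ _) (lin-unit (c ∘ fsuc) i)) (+-identityˡ _)

  lin-zero? : ∀ {k} (c : Fin k → ℝ) → (∀ x → lin c x ≡ 0r) ⊎ ∃[ x ] ¬ lin c x ≡ 0r
  lin-zero? c with any? (λ j → ¬? (c j ≟ 0r))
  ... | yes (j , cj≢0) = inj₂ (unit j , λ cu≡0 → cj≢0 (trans (sym (lin-unit c j)) cu≡0))
  ... | no ¬∃ = inj₁ λ x → lin-0ˡ c x λ j → decidable-stable (c j ≟ 0r) λ cj≢0 → ¬∃ (j , cj≢0)

  infix 5 ⟪_,_⟫ᶜ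
  ⟪_,_⟫ᶜ : ℂ^ d → ℂ^ d → ℝ
  ⟪ (a , b) , (x , y) ⟫ᶜ = lin a x + lin b y

  -- A real linear form on ℂ^d ≅ ℝ^d × ℝ^d is recorded by its pair of coefficient vectors.
  dualPair : DualPair R
  dualPair = record
    { Form = ℂ^ d
    ; Point = ℂ^ d
    ; ⟪_,_⟫ = ⟪_,_⟫ᶜ
    ; _+[_]_ = λ (x , y) t (x′ , y′) → combine x t x′ , combine y t y′
    ; _⊞[_]_ = λ (a , b) t (a′ , b′) → combine a t a′ , combine b t b′
    ; linearʳ = λ (a , b) (x , y) t (x′ , y′) →
        trans (cong₂ _+_ (lin-combineʳ a x t x′) (lin-combineʳ b y t y′)) (regroup _ t _ _ _)
    ; linearˡ = λ (a , b) t (a′ , b′) (x , y) →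
        trans (cong₂ _+_ (lin-combineˡ a t a′ x) (lin-combineˡ b t b′ y)) (regroup _ t _ _ _)
    ; origin = 0ᵥ , 0ᵥ
    ; ⟪-,origin⟫ = λ (a , b) → trans (cong₂ _+_ (lin-0ʳ a) (lin-0ʳ b)) (+-identityˡ 0r)
    ; zero? = zero?
    }
    where
    regroup : ∀ A t A′ B B′ → (A + t * A′) + (B + t * B′) ≡ (A + B) + t * (A′ + B′)
    regroup = solve 5 (λ A t A′ B B′ →
      (A :+ t :* A′) :+ (B :+ t :* B′) := (A :+ B) :+ t :* (A′ :+ B′)) refl
    zero? : ∀ f → (∀ v → ⟪ f , v ⟫ᶜ ≡ 0r) ⊎ ∃[ v ] ¬ ⟪ f , v ⟫ᶜ ≡ 0r
    zero? (a , b) with lin-zero? a | lin-zero? b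
    ... | inj₂ (x , ax≢0) | _ = inj₂ ((x , 0ᵥ) , λ e →
            ax≢0 (trans (sym (trans (cong (lin a x +_) (lin-0ʳ b)) (+-identityʳ _))) e))
    ... | inj₁ _ | inj₂ (y , by≢0) = inj₂ ((0ᵥ , y) , λ e →
            by≢0 (trans (sym (trans (cong (_+ lin b y) (lin-0ʳ a)) (+-identityˡ _))) e))
    ... | inj₁ a≡0 | inj₁ b≡0 = inj₁ λ (x , y) → trans (cong₂ _+_ (a≡0 x) (b≡0 y)) (+-identityˡ 0r)

module ComplexifiedArrangement (R : RealField) {d n : ℕ} (ℓ : Fin n → Fin d → RealField.ℝ R)
  (ℓ≢0 : ∀ e → ¬ (∀ j → ℓ e j ≡ RealField.0r R)) where

  open RealField R
  open Arrangement R
  open Signs R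
  open Complexified R d
  open DualPair dualPair

  form : Fin n ⊎ Fin n → ℂ^ d
  form (inj₁ i) = ℓ i , 0ᵥ
  form (inj₂ i) = 0ᵥ , ℓ i

  φ : Fin (n +ℕ n) → ℂ^ d
  φ k = form (splitAt n k)

  -- H_i ↦ H_i^ℜ and H_i^ℜ ↦ H_i^ℜ
  ρ : Fin (n +ℕ n) → Fin (n +ℕ n)
  ρ k = n ↑ʳ fromInj₂ (λ i → i) (splitAt n k)

  data Kind : Fin (n +ℕ n) → Set where
    complex : ∀ i → Kind (i ↑ˡ n)
    real    : ∀ i → Kind (n ↑ʳ i)

  kind : ∀ k → Kind k
  kind k with splitAt n k in eq
  ... | inj₁ i = subst Kind (splitAt⁻¹-↑ˡ eq) (complex i)
  ... | inj₂ i = subst Kind (splitAt⁻¹-↑ʳ eq) (real i)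

  φ-complex : ∀ i v → ⟪ φ (i ↑ˡ n) , v ⟫ ≡ reℓ (ℓ i) v
  φ-complex i (x , y) rewrite splitAt-↑ˡ n i n =
    trans (cong (lin (ℓ i) x +_) (lin-0ˡ 0ᵥ y λ _ → refl)) (+-identityʳ _)

  φ-real : ∀ i v → ⟪ φ (n ↑ʳ i) , v ⟫ ≡ imℓ (ℓ i) v
  φ-real i (x , y) rewrite splitAt-↑ʳ n n i =
    trans (cong (_+ lin (ℓ i) y) (lin-0ˡ 0ᵥ x λ _ → refl)) (+-identityˡ _)

  ρ-complex : ∀ i → ρ (i ↑ˡ n) ≡ n ↑ʳ i
  ρ-complex i rewrite splitAt-↑ˡ n i n = refl

  ρ-real : ∀ i → ρ (n ↑ʳ i) ≡ n ↑ʳ i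
  ρ-real i rewrite splitAt-↑ʳ n n i = refl

  φρ-complex : ∀ i v → ⟪ φ (ρ (i ↑ˡ n)) , v ⟫ ≡ imℓ (ℓ i) v
  φρ-complex i v rewrite ρ-complex i = φ-real i v

  φρ-real : ∀ i v → ⟪ φ (ρ (n ↑ʳ i)) , v ⟫ ≡ imℓ (ℓ i) v
  φρ-real i v rewrite ρ-real i = φ-real i v

  ρ-idem : ∀ k → ρ (ρ k) ≡ ρ k
  ρ-idem k = ρ-real _

  complex-moved : ∀ i → ¬ ρ (i ↑ˡ n) ≡ i ↑ˡ n
  complex-moved i ρk≡k
    with () ← trans (sym (splitAt-↑ʳ n n i))
                (trans (cong (splitAt n) (trans (sym (ρ-complex i)) ρk≡k)) (splitAt-↑ˡ n i n))

  dup prj : ℂ^ d → ℂ^ d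
  dup (x , y) = y , y
  prj (x , y) = 0ᵥ , y

  φ-dup : ∀ k v → ⟪ φ k , dup v ⟫ ≡ ⟪ φ (ρ k) , v ⟫
  φ-dup k v with kind k
  ... | complex i = trans (φ-complex i (dup v)) (sym (φρ-complex i v))
  ... | real i = trans (φ-real i (dup v)) (sym (φρ-real i v))

  φ-prj-fixed : ∀ k v → ρ k ≡ k → ⟪ φ k , prj v ⟫ ≡ ⟪ φ k , v ⟫
  φ-prj-fixed k v ρk≡k with kind k
  ... | complex i = contradiction ρk≡k (complex-moved i)
  ... | real i = trans (φ-real i (prj v)) (sym (φ-real i v))

  φ-prj-moved : ∀ k v → ¬ ρ k ≡ k → ⟪ φ k , prj v ⟫ ≡ 0r
  φ-prj-moved k v ρk≢k with kind k
  ... | complex i = trans (φ-complex i (prj v)) (lin-0ʳ (ℓ i))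
  ... | real i = contradiction (ρ-real i) ρk≢k

  φ≢0 : ∀ k → ∃[ v ] ¬ ⟪ φ k , v ⟫ ≡ 0r
  φ≢0 k with zero? (φ k)
  ... | inj₂ p = p
  ... | inj₁ φ≡0 with kind k
  ...   | complex i = contradiction
          (λ j → trans (sym (lin-unit (ℓ i) j)) (trans (sym (φ-complex i (unit j , 0ᵥ))) (φ≡0 (unit j , 0ᵥ)))) (ℓ≢0 i)
  ...   | real i = contradiction
          (λ j → trans (sym (lin-unit (ℓ i) j)) (trans (sym (φ-real i (0ᵥ , unit j))) (φ≡0 (0ᵥ , unit j)))) (ℓ≢0 i)

  open LinearMatroid R dualPair φ
  open FeasibleSets R dualPair φ ρ ρ-idem dup prj φ-dup φ-prj-fixed φ-prj-moved

  -- Symbols and subspaces in terms of the forms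

  σRe-0 : ∀ x {y} → y ≡ 0r → σRe x y ≡ σIm x
  σRe-0 x {y} y≡0 with compare 0r y
  ... | tri< _ 0≢y _ = contradiction (sym y≡0) 0≢y
  ... | tri≈ _ _ _ = refl
  ... | tri> _ 0≢y _ = contradiction (sym y≡0) 0≢y

  σRe-≢0 : ∀ x {y} → ¬ y ≡ 0r → σRe x y ≡ 𝟙
  σRe-≢0 x {y} y≢0 with compare 0r y
  ... | tri< _ _ _ = refl
  ... | tri≈ _ 0≡y _ = contradiction (sym 0≡y) y≢0
  ... | tri> _ _ _ = refl

  alpha-complex : ∀ i v → alpha ℓ v (i ↑ˡ n) ≡ σRe (reℓ (ℓ i) v) (imℓ (ℓ i) v)
  alpha-complex i v rewrite splitAt-↑ˡ n i n = refl

  alpha-real : ∀ i v → alpha ℓ v (n ↑ʳ i) ≡ σIm (imℓ (ℓ i) v)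
  alpha-real i v rewrite splitAt-↑ʳ n n i = refl

  alpha-low : ∀ {k v} → ρ k ≡ k ⊎ ⟪ φ (ρ k) , v ⟫ ≡ 0r → alpha ℓ v k ≡ σIm ⟪ φ k , v ⟫
  alpha-low {k} {v} low with kind k | low
  ... | complex i | inj₁ ρk≡k = contradiction ρk≡k (complex-moved i)
  ... | complex i | inj₂ ρkv≡0 = trans (alpha-complex i v)
          (trans (σRe-0 _ (trans (sym (φρ-complex i v)) ρkv≡0)) (cong σIm (sym (φ-complex i v))))
  ... | real i | _ = trans (alpha-real i v) (cong σIm (sym (φ-real i v)))

  alpha-high : ∀ {k v} → ¬ ρ k ≡ k → ¬ ⟪ φ (ρ k) , v ⟫ ≡ 0r → alpha ℓ v k ≡ 𝟙
  alpha-high {k} {v} ρk≢k ρkv≢0 with kind k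
  ... | complex i = trans (alpha-complex i v) (σRe-≢0 _ λ y≡0 → ρkv≢0 (trans (φρ-complex i v) y≡0))
  ... | real i = contradiction (ρ-real i) ρk≢k

  InE-complex : ∀ i v → InE ℓ (i ↑ˡ n) v ≡ (reℓ (ℓ i) v ≡ 0r × imℓ (ℓ i) v ≡ 0r)
  InE-complex i v rewrite splitAt-↑ˡ n i n = refl

  InE-real : ∀ i v → InE ℓ (n ↑ʳ i) v ≡ (imℓ (ℓ i) v ≡ 0r)
  InE-real i v rewrite splitAt-↑ʳ n n i = refl

  InE⇒null : ∀ k v → InE ℓ k v → Null v k
  InE⇒null k v k∋v with kind k
  ... | complex i rewrite InE-complex i v with x≡0 , y≡0 ← k∋v =
          trans (φ-complex i v) x≡0 , trans (φρ-complex i v) y≡0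
  ... | real i rewrite InE-real i v = trans (φ-real i v) k∋v , trans (φρ-real i v) k∋v

  null⇒InE : ∀ k v → Null v k → InE ℓ k v
  null⇒InE k v (kv≡0 , ρkv≡0) with kind k
  ... | complex i rewrite InE-complex i v =
          trans (sym (φ-complex i v)) kv≡0 , trans (sym (φρ-complex i v)) ρkv≡0
  ... | real i rewrite InE-real i v = trans (sym (φ-real i v)) kv≡0

  cap⇒ker : ∀ {S v} → Cap ℓ S v → Ker S v
  cap⇒ker {v = v} v∈cap k k∈S = proj₁ (InE⇒null k v (v∈cap k k∈S))

  -- For H_i in S, `Cap` asks both parts of ℓ_i to vanish but `Ker` only the real part; feasibility
  -- of S supplies the imaginary one.
  ker⇒cap : ∀ {S v} → Feasible S → Ker S v → Cap ℓ S v
  ker⇒cap {v = v} fS v∈ker k k∈S = null⇒InE k v (cl⇒null fS v∈ker (cl-∈ k∈S))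

  cap-mono : ∀ {S T v} → S ⊆ T → Cap ℓ T v → Cap ℓ S v
  cap-mono S⊆T v∈cap k k∈S = v∈cap k (S⊆T k∈S)

  -- If ρ(h) is neither h nor spanned by S, then adjoining ρ(h) instead of h gives a subspace
  -- strictly between the two, so there is no cover.
  covers⇒extensible : ∀ {S h} → Feasible S → Covers ℓ (Cap ℓ S) (Cap ℓ (S ∪ ⁅ h ⁆)) → Extensible S h
  covers⇒extensible {S} {h} fS ((_ , S⋢S∪h) , between) =
    extensible-intro h∉cl (decidable-stable ((ρ h ≟ᶠ h) ⊎-dec cl? S (ρ h)) λ ¬ρh →
      between (S ∪ ⁅ ρ h ⁆ , between-S∪ρh (¬ρh ∘ inj₁) (¬ρh ∘ inj₂)))
    where
    h∉cl : ¬ Cl S h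
    h∉cl h∈cl = S⋢S∪h λ v v∈S →
      ∪-all v∈S (null⇒InE h v (cl⇒null fS (cap⇒ker v∈S) h∈cl))
    between-S∪ρh : ¬ ρ h ≡ h → ¬ Cl S (ρ h) →
      _⊏_ ℓ (Cap ℓ (S ∪ ⁅ h ⁆)) (Cap ℓ (S ∪ ⁅ ρ h ⁆)) × _⊏_ ℓ (Cap ℓ (S ∪ ⁅ ρ h ⁆)) (Cap ℓ S)
    between-S∪ρh ρh≢h ρh∉cl =
        ( (λ v v∈ → ∪-all (cap-mono (p⊆p∪q ⁅ h ⁆) v∈)
            (null⇒InE (ρ h) v (null-ρ (InE⇒null h v (v∈ h (x∈p∪⁅x⁆ S h))))))
        -- Equality would put h in cl(S ∪ ρ(h)), hence by exchange ρ(h) in cl(S ∪ h); since h is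
        -- moved, ρ(h) would be in cl(S).
        , λ S∪ρh⊑S∪h →
            ρh∉cl (ρ-cl-trans (∪-all (λ _ f∈S _ → cl-∈ f∈S) (λ ρh≡h → contradiction ρh≡h ρh≢h))
              (exchange h∉cl λ v v∈ker →
                cap⇒ker (S∪ρh⊑S∪h v (ker⇒cap fS∪ρh v∈ker)) h (x∈p∪⁅x⁆ S h))))
      , ( (λ v → cap-mono (p⊆p∪q ⁅ ρ h ⁆))
        , λ S⊑S∪ρh → ρh∉cl λ v v∈ker →
            cap⇒ker (S⊑S∪ρh v (ker⇒cap fS v∈ker)) (ρ h) (x∈p∪⁅x⁆ S (ρ h)))
      where
      fS∪ρh : Feasible (S ∪ ⁅ ρ h ⁆)
      fS∪ρh = extend-feasible fS (extensible-intro ρh∉cl (inj₁ (ρ-idem h)))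

  -- The step has real codimension one. A form that vanishes on an intermediate `Cap ℓ T` lies in
  -- cl(S ∪ h); if it were not in cl(S), exchange would make φ_h vanish on `Cap ℓ T` too, collapsing
  -- T to the bottom. So all forms of T lie in cl(S), collapsing T to the top. No feasibility of T
  -- enters, hence the argument by forms.
  extensible⇒covers : ∀ {S h} → Feasible S → Extensible S h → Covers ℓ (Cap ℓ S) (Cap ℓ (S ∪ ⁅ h ⁆))
  extensible⇒covers {S} {h} fS ext@(h∉cl , _) =
      ( (λ v → cap-mono (p⊆p∪q ⁅ h ⁆))
      , λ S⊑S∪h → h∉cl λ v v∈ker → cap⇒ker (S⊑S∪h v (ker⇒cap fS v∈ker)) h (x∈p∪⁅x⁆ S h))
    , λ (T , (S∪h⊑T , T⋢S∪h) , (T⊑S , S⋢T)) →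
        S⋢T λ v v∈S k k∈T → null⇒InE k v
          ( T⊆cl T S∪h⊑T T⋢S∪h T⊑S k (λ u u∈T → proj₁ (InE⇒null k u (u∈T k k∈T))) v (cap⇒ker v∈S)
          , T⊆cl T S∪h⊑T T⋢S∪h T⊑S (ρ k) (λ u u∈T → proj₂ (InE⇒null k u (u∈T k k∈T))) v (cap⇒ker v∈S))
    where
    fS∪h : Feasible (S ∪ ⁅ h ⁆)
    fS∪h = extend-feasible fS ext
    T⊆cl : ∀ T → _⊑_ ℓ (Cap ℓ (S ∪ ⁅ h ⁆)) (Cap ℓ T) → ¬ _⊑_ ℓ (Cap ℓ T) (Cap ℓ (S ∪ ⁅ h ⁆)) →
      _⊑_ ℓ (Cap ℓ T) (Cap ℓ S) → ∀ f → (∀ v → Cap ℓ T v → ⟪ φ f , v ⟫ ≡ 0r) → Cl S f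
    T⊆cl T S∪h⊑T T⋢S∪h T⊑S f T⊆f = decidable-stable (cl? S f) λ f∉cl →
      T⋢S∪h λ v v∈T → ker⇒cap fS∪h (ker-∪ (cap⇒ker (T⊑S v v∈T))
        (exchange f∉cl (λ u u∈ker → T⊆f u (S∪h⊑T u (ker⇒cap fS∪h u∈ker))) v
          (ker-∪ (cap⇒ker (T⊑S v v∈T)) (T⊆f v v∈T))))

  chain⇒feasible : ∀ {S} hs → Feasible S → ChainFrom ℓ S hs → Feasible (S ∪ toSet ℓ hs)
  chain⇒feasible {S} [] fS _ = subst Feasible (sym (∪-identityʳ S)) fS
  chain⇒feasible {S} (h ∷ hs) fS (cov , chain) = subst Feasible (∪-assoc S ⁅ h ⁆ (toSet ℓ hs))
    (chain⇒feasible hs (extend-feasible fS (covers⇒extensible fS cov)) chain)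

  FA⇒feasible : ∀ {X} → FA ℓ X → Feasible X
  FA⇒feasible (hs , chain , refl) =
    subst Feasible (∪-identityˡ (toSet ℓ hs)) (chain⇒feasible hs feasible-⊥ chain)

  -- `ChainFrom` unfolds from the first element, whereas feasible sets are built up by adjoining a
  -- last one.
  chain-∷ʳ : ∀ {S} hs {h} → ChainFrom ℓ S hs →
    Covers ℓ (Cap ℓ (S ∪ toSet ℓ hs)) (Cap ℓ ((S ∪ toSet ℓ hs) ∪ ⁅ h ⁆)) → ChainFrom ℓ S (hs ∷ʳ h)
  chain-∷ʳ {S} [] {h} _ cov = subst (λ T → Covers ℓ (Cap ℓ T) (Cap ℓ (T ∪ ⁅ h ⁆))) (∪-identityʳ S) cov , tt
  chain-∷ʳ {S} (g ∷ hs) {h} (cov , chain) cov′ = cov , chain-∷ʳ hs chain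
    (subst (λ T → Covers ℓ (Cap ℓ T) (Cap ℓ (T ∪ ⁅ h ⁆))) (sym (∪-assoc S ⁅ g ⁆ (toSet ℓ hs))) cov′)

  toSet-∷ʳ : ∀ hs h → toSet ℓ (hs ∷ʳ h) ≡ toSet ℓ hs ∪ ⁅ h ⁆
  toSet-∷ʳ [] h = trans (∪-identityʳ ⁅ h ⁆) (sym (∪-identityˡ ⁅ h ⁆))
  toSet-∷ʳ (g ∷ hs) h = trans (cong (⁅ g ⁆ ∪_) (toSet-∷ʳ hs h)) (sym (∪-assoc ⁅ g ⁆ (toSet ℓ hs) ⁅ h ⁆))

  FA-extend : ∀ {S h} → FA ℓ S → Feasible S → Extensible S h → FA ℓ (S ∪ ⁅ h ⁆)
  FA-extend {h = h} (hs , chain , refl) fS ext = hs ∷ʳ h ,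
    chain-∷ʳ hs chain (subst (λ T → Covers ℓ (Cap ℓ T) (Cap ℓ (T ∪ ⁅ h ⁆)))
      (sym (∪-identityˡ (toSet ℓ hs))) (extensible⇒covers fS ext)) ,
    sym (toSet-∷ʳ hs h)

  -- `shrink` removes an element by which the remainder is extensible, and this extension is the
  -- last cover of the chain.
  feasible⇒FA′ : ∀ k {X} → ∣ X ∣ <ℕ k → Feasible X → FA ℓ X
  feasible⇒FA′ (ℕ.suc k) {X} (s≤s ∣X∣≤k) fX with nonempty? X
  ... | no X≡∅ = [] , tt , Empty-unique X≡∅
  ... | yes X≢∅ with x , x∈X , fX-x , ext ← shrink fX X≢∅ =
    subst (FA ℓ) (⊆-antisym (∪-all (λ _ → p-x⊆p X x) x∈X _) (p⊆[p-x]∪⁅x⁆ X x))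
      (FA-extend (feasible⇒FA′ k (ℕ.<-≤-trans (x∈p⇒∣p-x∣<∣p∣ x∈X) ∣X∣≤k) fX-x) fX-x ext)

  feasible⇒FA : ∀ {X} → Feasible X → FA ℓ X
  feasible⇒FA = feasible⇒FA′ _ ℕ.≤-refl

  open Oriented φ≢0 (FA ℓ) FA⇒feasible feasible⇒FA (alpha ℓ) alpha-low alpha-high public
    using (isOrientedIntervalGreedoid)

mainTheorem8 : (R : RealField) (d n : ℕ) (ℓ : Fin n → Fin d → RealField.ℝ R) →
  -- each Θ_e = ker ℓ_e is a hyperplane (ℓ_e ≠ 0)
  (∀ e → ¬ (∀ j → ℓ e j ≡ RealField.0r R)) →
  -- the hyperplanes Θ_1, …, Θ_n are pairwise distinct
  (∀ e e′ → ¬ (e ≡ e′) →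
    ¬ (∀ x → (Arrangement.Θ R (ℓ e) x → Arrangement.Θ R (ℓ e′) x)
           × (Arrangement.Θ R (ℓ e′) x → Arrangement.Θ R (ℓ e) x))) →
  -- ⋂ Θ_i = {0}
  (∀ x → (∀ e → Arrangement.Θ R (ℓ e) x) → ∀ j → x j ≡ RealField.0r R) →
  Greedoid.IsOrientedIntervalGreedoid (Arrangement.FA R ℓ) (Arrangement.LA R ℓ)
mainTheorem8 R d n ℓ ℓ≢0 _ _ = ComplexifiedArrangement.isOrientedIntervalGreedoid R ℓ ℓ≢0
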